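{- Let $A=\{\mathsf{x},\mathsf{y},\mathsf{z}\}$ with the quasi-ordering $\sqsubseteq$ that is the reflexive closure of $\{(\mathsf{x},\mathsf{z}),(\mathsf{y},\mathsf{z})\}$ (so $\mathsf{x}\sqsubseteq\mathsf{z}\sqsupseteq\mathsf{y}$ and $\mathsf{x},\mathsf{y}$ are incomparable). Then the satisfiability problem of $\mathrm{LTL}^{\downarrow}_A$ is undecidable.
   Context: Let $\Sigma$ be a finite alphabet (part of the input), $\Delta$ an infinite set of data values (with equality only). An $A$-attributed data word is a non-empty finite sequence $w=(a_1,\mathbf{d}_1)\dots(a_n,\mathbf{d}_n)$ with $a_i\in\Sigma$, $\mathbf{d}_i:A\to\Delta$. Formulae: $\varphi::=a\mid\neg\varphi\mid\varphi\wedge\varphi\mid \mathrm{X}\varphi\mid\varphi\,\mathrm{U}\,\varphi\mid\downarrow^x\varphi\mid\ \uparrow^x$ ($a\in\Sigma$, $x\in A$). Let $\mathrm{cl}(x)=\{y\mid y\sqsubseteq x\}$, $\mathbf{d}|_x$ the restriction to $\mathrm{cl}(x)$, $\Delta^A_\perp=\{\mathbf{d}:\mathrm{cl}(x)\to\Delta\mid x\in A\}$, and $\mathbf{d}\simeq\mathbf{d}'$ iff there is a bijection $h:\mathrm{dom}(\mathbf{d})\to\mathrm{dom}(\mathbf{d}')$ with $\mathbf{d}(x)=\mathbf{d}'(h(x))$ and $x\sqsubseteq y\Leftrightarrow h(x)\sqsubseteq h(y)$. Semantics for $1\le i\le n$, $\mathbf{d}\in\Delta^A_\perp$: $(w,i,\mathbf{d})\models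 a$ iff $a_i=a$; Boolean connectives as usual; $\mathrm{X}\varphi$ holds iff $i+1\le n$ and $(w,i+1,\mathbf{d})\models\varphi$; $\varphi\,\mathrm{U}\,\psi$ holds iff some $i\le k\le n$ has $(w,k,\mathbf{d})\models\psi$ and $(w,j,\mathbf{d})\models\varphi$ for $i\le j<k$; $(w,i,\mathbf{d})\models\downarrow^x\varphi$ iff $(w,i,\mathbf{d}_i|_x)\models\varphi$; $(w,i,\mathbf{d})\models\uparrow^x$ iff $\mathbf{d}|_y\simeq\mathbf{d}_i|_x$ for some $y\in A$. A formula is satisfiable if $(w,1,\mathbf{d})\models\varphi$ for some $w$ and $\mathbf{d}$. -}

module Defs where

open import Data.Nat using (ℕ; zero; suc)
open import Data.Fin using (Fin; toℕ) renaming (_≤_ to _≤ᶠ_; _<_ to _<ᶠ_)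
open import Data.Product using (Σ; _×_; _,_; proj₁; proj₂)
open import Relation.Binary.PropositionalEquality using (_≡_)
open import Relation.Nullary using (¬_)
open import Function.Bundles using (_⤖_; _⇔_; Bijection)
open import Relation.Binary.Construct.Closure.ReflexiveTransitive using (Star)

data Attr : Set where
  ax ay az : Attr

data _⊑_ : Attr → Attr → Set where
  ⊑-refl : ∀ {a} → a ⊑ a
  x⊑z    : ax ⊑ az
  y⊑z    : ay ⊑ az

⊑-trans : ∀ {a b c} → a ⊑ b → b ⊑ c → a ⊑ c
⊑-trans ⊑-refl q = q
⊑-trans x⊑z ⊑-refl = x⊑z
⊑-trans y⊑z ⊑-refl = y⊑z

-- Data values Δ: we fix Δ = ℕ (an infinite set, compared by equality only)

Δ : Set
Δ = ℕ

-- Elements of Δ^A_⊥ : maps cl(x) → Δ for some x ∈ A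
record PVal : Set where
  constructor pval
  field
    root : Attr
    val  : (y : Attr) → y ⊑ root → Δ
open PVal public

Dom : PVal → Set
Dom d = Σ Attr (λ y → y ⊑ root d)

_≃ᵈ_ : PVal → PVal → Set
d ≃ᵈ d' = Σ (Dom d ⤖ Dom d') λ h →
  ((u : Dom d) → val d (proj₁ u) (proj₂ u)
                 ≡ val d' (proj₁ (Bijection.to h u)) (proj₂ (Bijection.to h u)))
  × ((u v : Dom d) → (proj₁ u ⊑ proj₁ v) ⇔ (proj₁ (Bijection.to h u) ⊑ proj₁ (Bijection.to h v)))

restrictFull : (Attr → Δ) → Attr → PVal
restrictFull f x = pval x (λ y _ → f y)

restrictP : (d : PVal) (y : Attr) → y ⊑ root d → PVal
restrictP d y q = pval y (λ z p → val d z (⊑-trans p q))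

data Formula (k : ℕ) : Set where
  letter : Fin k → Formula k
  neg    : Formula k → Formula k
  conj   : Formula k → Formula k → Formula k
  next   : Formula k → Formula k
  until  : Formula k → Formula k → Formula k
  down   : Attr → Formula k → Formula k
  up     : Attr → Formula k

-- A-attributed data words (non-empty): positions Fin (suc len)
record Word (k : ℕ) : Set where
  field
    len : ℕ
    lab : Fin (suc len) → Fin k
    dat : Fin (suc len) → Attr → Δ
open Word public

Models : ∀ {k} (w : Word k) → Fin (suc (len w)) → PVal → Formula k → Set
Models w i d (letter a)  = lab w i ≡ a
Models w i d (neg φ)     = ¬ Models w i d φ
Models w i d (conj φ ψ)  = Models w i d φ × Models w i d ψ
Models w i d (next φ)    = Σ (Fin (suc (len w))) λ j → (toℕ j ≡ suc (toℕ i)) × Models w j d φ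
Models w i d (until φ ψ) = Σ (Fin (suc (len w))) λ j → (i ≤ᶠ j) × Models w j d ψ
                             × ((m : Fin (suc (len w))) → i ≤ᶠ m → m <ᶠ j → Models w m d φ)
Models w i d (down x φ)  = Models w i (restrictFull (dat w i) x) φ
Models w i d (up x)      = Σ Attr λ y → Σ (y ⊑ root d) λ q → restrictP d y q ≃ᵈ restrictFull (dat w i) x

SatInstance : Set
SatInstance = Σ ℕ Formula

Satisfiable : SatInstance → Set
Satisfiable (k , φ) = Σ (Word k) λ w → Σ PVal λ d → Models w Data.Fin.zero d φ

data Ctr : Set where
  c₁ c₂ : Ctr

data Instr (n : ℕ) : Set where
  INC  : Ctr → Fin n → Instr n
  DEC  : Ctr → Fin n → Fin n → Instr n  -- DEC c j l: if c = 0 goto l, else c := c-1, goto j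
  HALT : Instr n

Machine : Set
Machine = Σ ℕ λ n → (Fin (suc n) → Instr (suc n))

Config : ℕ → Set
Config n = Fin n × ℕ × ℕ

data Step {n : ℕ} (P : Fin n → Instr n) : Config n → Config n → Set where
  inc₁  : ∀ {pc j a b} → P pc ≡ INC c₁ j → Step P (pc , a , b) (j , suc a , b)
  inc₂  : ∀ {pc j a b} → P pc ≡ INC c₂ j → Step P (pc , a , b) (j , a , suc b)
  dec₁z : ∀ {pc j l b} → P pc ≡ DEC c₁ j l → Step P (pc , zero , b) (l , zero , b)
  dec₁s : ∀ {pc j l a b} → P pc ≡ DEC c₁ j l → Step P (pc , suc a , b) (j , a , b)
  dec₂z : ∀ {pc j l a} → P pc ≡ DEC c₂ j l → Step P (pc , a , zero) (l , a , zero)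
  dec₂s : ∀ {pc j l a b} → P pc ≡ DEC c₂ j l → Step P (pc , a , suc b) (j , a , b)

Halts : Machine → Set
Halts (n , P) = Σ (Config (suc n)) λ c →
  Star (Step P) (Data.Fin.zero , 0 , 0) c × (P (proj₁ c) ≡ HALT)

-- Undecidability, synthetically: a (necessarily computable, being an Agda
-- function) many-one reduction from the halting problem.
_⪯_ : ∀ {A B : Set} → (A → Set) → (B → Set) → Set
_⪯_ {A} {B} p q = Σ (A → B) λ f → (a : A) → p a ⇔ q (f a)

-- A configuration (pc, m₁, m₂) is written as the block  h_pc aᵐ¹ k bᵐ²  and a
-- run as the concatenation of the blocks of its configurations.  The h- and
-- k-cells carry the x-value s₀ of the first cell; inside an a-run (b-run) the
-- x-values are pairwise distinct and differ from s₀, and the y-value of each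
-- cell is the x-value of its predecessor: a counter value m is stored as a
-- "chain" s₀ → v₁ → … → vₘ.  The test ↑z compares the z-value together with
-- the UNORDERED pair {x, y} (an isomorphism of cl(z) may swap the incomparable
-- x and y); with it Φ demands that every cell of a block reappears in the next
-- block.  A combinatorial lemma on chains (chainPrefix) then shows that the new
-- chain extends the old one, so comparing last x/y-values with ↑x, ↑y decides
-- whether a counter was kept, incremented or decremented.
module Submission where

open import Defs
open import Data.Nat as ℕ using (ℕ; zero; suc; _+_; _∸_; z≤n; s≤s)
import Data.Nat.Properties as ℕP
open import Data.Fin as F using (Fin; toℕ; fromℕ<)
open Fin
import Data.Fin.Properties as FP
open import Data.List using (List; []; _∷_; _++_; map; length; [_])
import Data.List.Properties as LP
open import Data.List.Relation.Unary.All as All using (All; []; _∷_)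
import Data.List.Relation.Unary.All.Properties as AllP
open import Data.List.Relation.Unary.Any using (Any; here; there) renaming (map to mapAny)
import Data.List.Relation.Unary.Any.Properties as AnyP
open import Data.List.Relation.Unary.AllPairs using ([]; _∷_)
open import Data.List.Relation.Unary.Unique.Propositional using (Unique)
open import Data.List.Membership.Propositional using (_∈_; find)
open import Data.Product using (Σ; _×_; _,_; proj₁; proj₂)
open import Data.Sum using (_⊎_; inj₁; inj₂)
open import Data.Empty using (⊥; ⊥-elim)
open import Relation.Nullary using (¬_; Dec; yes; no)
open import Relation.Nullary.Decidable using (_×-dec_; _⊎-dec_; ¬?)
open import Relation.Binary.PropositionalEquality
  using (_≡_; _≢_; refl; sym; trans; cong; cong₂; subst; subst₂)
open import Relation.Binary.Construct.Closure.ReflexiveTransitive using (Star; ε; _◅_; _◅◅_)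
open import Function using (_∘_; case_of_)
open import Function.Bundles using (_⤖_; _⇔_; Bijection; mk⇔; mk⤖; module Equivalence)

-- (1) List semantics.  A cell is a letter with its attribute valuation; a
-- formula is evaluated at a cell s followed by the list r of later cells.

Val : Set
Val = Attr → Δ

Cell : ℕ → Set
Cell k = Fin k × Val

data Until {k : ℕ} (P Q : Cell k → List (Cell k) → Set) : Cell k → List (Cell k) → Set where
  here : ∀ {s r} → Q s r → Until P Q s r
  step : ∀ {s s' r} → P s (s' ∷ r) → Until P Q s' r → Until P Q s (s' ∷ r)

AtHead : ∀ {k} → (Cell k → List (Cell k) → Set) → List (Cell k) → Set
AtHead P []      = ⊥
AtHead P (s ∷ r) = P s r

Sat : ∀ {k} → Cell k → List (Cell k) → PVal → Formula k → Set
Sat s r d (letter a)  = proj₁ s ≡ a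
Sat s r d (neg φ)     = ¬ Sat s r d φ
Sat s r d (conj φ ψ)  = Sat s r d φ × Sat s r d ψ
Sat s r d (next φ)    = AtHead (λ s' r' → Sat s' r' d φ) r
Sat s r d (until φ ψ) = Until (λ s' r' → Sat s' r' d φ) (λ s' r' → Sat s' r' d ψ) s r
Sat s r d (down x φ)  = Sat s r (restrictFull (proj₂ s) x) φ
Sat s r d (up x)      = Σ Attr λ y → Σ (y ⊑ root d) λ q → restrictP d y q ≃ᵈ restrictFull (proj₂ s) x

after : ∀ {A : Set} {L} → (Fin (suc L) → A) → Fin (suc L) → List A
after {L = zero}  f zero    = []
after {L = suc L} f zero    = f (suc zero) ∷ after (f ∘ suc) zero
after {L = suc L} f (suc i) = after (f ∘ suc) i

after-last : ∀ {A : Set} {L} (f : Fin (suc L) → A) (i : Fin (suc L)) → toℕ i ≡ L → after f i ≡ []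
after-last {L = zero}  f zero    e = refl
after-last {L = suc L} f (suc i) e = after-last (f ∘ suc) i (ℕP.suc-injective e)

after-next : ∀ {A : Set} {L} (f : Fin (suc L) → A) (i j : Fin (suc L)) →
             toℕ j ≡ suc (toℕ i) → after f i ≡ f j ∷ after f j
after-next {L = suc L} f zero    (suc zero)    e = refl
after-next {L = suc L} f (suc i) (suc j)       e = after-next (f ∘ suc) i j (ℕP.suc-injective e)
after-next {L = suc L} f zero    (suc (suc j)) ()
after-next {L = suc L} f (suc i) zero          ()

lastOrNext : ∀ {L} (i : Fin (suc L)) → toℕ i ≡ L ⊎ Σ (Fin (suc L)) λ j → toℕ j ≡ suc (toℕ i)
lastOrNext {L} i with toℕ i ℕ.<? L
... | yes lt = inj₂ (fromℕ< (s≤s lt) , FP.toℕ-fromℕ< (s≤s lt))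
... | no ¬lt = inj₁ (ℕP.≤-antisym (ℕP.≤-pred (FP.toℕ<n i)) (ℕP.≮⇒≥ ¬lt))

cellAt : ∀ {k} (w : Word k) → Fin (suc (len w)) → Cell k
cellAt w i = lab w i , dat w i

module _ {k : ℕ} (w : Word k) where
  private
    c = cellAt w
    SatAt : PVal → Formula k → Fin (suc (len w)) → Set
    SatAt d φ i = Sat (c i) (after c i) d φ

  models⇔sat : ∀ φ i d → Models w i d φ ⇔ SatAt d φ i

  until→ : ∀ φ ψ d n (i j : Fin (suc (len w))) → toℕ j ≡ n + toℕ i → Models w j d ψ →
           (∀ m → i F.≤ m → m F.< j → Models w m d φ) →
           Until (λ s r → Sat s r d φ) (λ s r → Sat s r d ψ) (c i) (after c i)
  until← : ∀ φ ψ d i {s r} → s ≡ c i → r ≡ after c i →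
           Until (λ s r → Sat s r d φ) (λ s r → Sat s r d ψ) s r → Models w i d (until φ ψ)

  models⇔sat (letter a)  i d = mk⇔ (λ e → e) (λ e → e)
  models⇔sat (neg φ)     i d = mk⇔ (λ h m → h (Equivalence.from (models⇔sat φ i d) m))
                                   (λ h m → h (Equivalence.to (models⇔sat φ i d) m))
  models⇔sat (conj φ ψ)  i d = mk⇔ (λ (p , q) → Equivalence.to (models⇔sat φ i d) p , Equivalence.to (models⇔sat ψ i d) q)
                                   (λ (p , q) → Equivalence.from (models⇔sat φ i d) p , Equivalence.from (models⇔sat ψ i d) q)
  models⇔sat (next φ)    i d = mk⇔ to from
    where
    to : Models w i d (next φ) → SatAt d (next φ) i
    to (j , e , m) rewrite after-next c i j e = Equivalence.to (models⇔sat φ j d) m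
    from : SatAt d (next φ) i → Models w i d (next φ)
    from h with lastOrNext i
    ... | inj₁ e rewrite after-last c i e = ⊥-elim h
    ... | inj₂ (j , e) rewrite after-next c i j e = j , e , Equivalence.from (models⇔sat φ j d) h
  models⇔sat (until φ ψ) i d = mk⇔ (λ (j , i≤j , m , hs) → until→ φ ψ d (toℕ j ∸ toℕ i) i j (sym (ℕP.m∸n+n≡m i≤j)) m hs)
                                   (until← φ ψ d i refl refl)
  models⇔sat (down x φ)  i d = models⇔sat φ i (restrictFull (dat w i) x)
  models⇔sat (up x)      i d = mk⇔ (λ h → h) (λ h → h)

  until→ φ ψ d zero i j e mψ hφ with FP.toℕ-injective e
  ... | refl = here (Equivalence.to (models⇔sat ψ i d) mψ)
  until→ φ ψ d (suc n) i j e mψ hφ with lastOrNext i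
  ... | inj₁ i-last = ⊥-elim (ℕP.<⇒≱ i<j (subst (toℕ j ℕ.≤_) (sym i-last) (ℕP.≤-pred (FP.toℕ<n j))))
    where i<j = subst (toℕ i ℕ.<_) (sym e) (ℕP.m<n+m (toℕ i) (s≤s z≤n))
  ... | inj₂ (i' , e') = subst (Until _ _ (c i)) (sym next≡)
    (step (subst (λ r → Sat (c i) r d φ) next≡ (Equivalence.to (models⇔sat φ i d) (hφ i ℕP.≤-refl i<j)))
         (until→ φ ψ d n i' j (trans e (trans (sym (ℕP.+-suc n (toℕ i))) (cong (n +_) (sym e'))))
                 mψ (λ m i'≤m m<j → hφ m (ℕP.≤-trans (ℕP.n≤1+n _) (subst (ℕ._≤ toℕ m) e' i'≤m)) m<j)))
    where
    i<j = subst (toℕ i ℕ.<_) (sym e) (ℕP.m<n+m (toℕ i) (s≤s z≤n))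
    next≡ = after-next c i i' e'

  until← φ ψ d i es er (here q) =
    i , ℕP.≤-refl , Equivalence.from (models⇔sat ψ i d) (subst₂ (λ s r → Sat s r d ψ) es er q) ,
    λ m i≤m m<i → ⊥-elim (ℕP.<⇒≱ m<i i≤m)
  until← φ ψ d i es er (step p u) with lastOrNext i
  ... | inj₁ i-last with trans er (after-last c i i-last)
  ...   | ()
  until← φ ψ d i es er (step p u) | inj₂ (i' , e') with trans er (after-next c i i' e')
  ... | refl with until← φ ψ d i' refl refl u
  ...   | j , i'≤j , mj , hs = j , ℕP.≤-trans (ℕP.n≤1+n _) (subst (ℕ._≤ toℕ j) e' i'≤j) , mj , earlier
    where
    earlier : ∀ m → i F.≤ m → m F.< j → Models w m d φ
    earlier m i≤m m<j with ℕP.m≤n⇒m<n∨m≡n i≤m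
    ... | inj₁ i<m = hs m (subst (ℕ._≤ toℕ m) (sym e') i<m) m<j
    ... | inj₂ i≡m with FP.toℕ-injective i≡m
    ...   | refl = Equivalence.from (models⇔sat φ i d) (subst₂ (λ s r → Sat s r d φ) es (sym (after-next c i i' e')) p)

-- (2) Isomorphism of partial valuations, made concrete.  Valuations rooted at
-- x or y have a single value; valuations rooted at z are isomorphic iff the
-- z-values agree and the x,y-values agree up to a swap.

IsoSpec : PVal → PVal → Set
IsoSpec (pval ax f) (pval ax g) = f ax ⊑-refl ≡ g ax ⊑-refl
IsoSpec (pval ax f) (pval ay g) = f ax ⊑-refl ≡ g ay ⊑-refl
IsoSpec (pval ay f) (pval ax g) = f ay ⊑-refl ≡ g ax ⊑-refl
IsoSpec (pval ay f) (pval ay g) = f ay ⊑-refl ≡ g ay ⊑-refl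
IsoSpec (pval az f) (pval az g) = (f az ⊑-refl ≡ g az ⊑-refl) ×
  ((f ax x⊑z ≡ g ax x⊑z × f ay y⊑z ≡ g ay y⊑z) ⊎ (f ax x⊑z ≡ g ay y⊑z × f ay y⊑z ≡ g ax x⊑z))
IsoSpec (pval ax f) (pval az g) = ⊥
IsoSpec (pval ay f) (pval az g) = ⊥
IsoSpec (pval az f) (pval ax g) = ⊥
IsoSpec (pval az f) (pval ay g) = ⊥

isoSpec? : ∀ d d' → Dec (IsoSpec d d')
isoSpec? (pval ax f) (pval ax g) = f ax ⊑-refl ℕP.≟ g ax ⊑-refl
isoSpec? (pval ax f) (pval ay g) = f ax ⊑-refl ℕP.≟ g ay ⊑-refl
isoSpec? (pval ay f) (pval ax g) = f ay ⊑-refl ℕP.≟ g ax ⊑-refl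
isoSpec? (pval ay f) (pval ay g) = f ay ⊑-refl ℕP.≟ g ay ⊑-refl
isoSpec? (pval az f) (pval az g) = (f az ⊑-refl ℕP.≟ g az ⊑-refl) ×-dec
  (((f ax x⊑z ℕP.≟ g ax x⊑z) ×-dec (f ay y⊑z ℕP.≟ g ay y⊑z)) ⊎-dec
   ((f ax x⊑z ℕP.≟ g ay y⊑z) ×-dec (f ay y⊑z ℕP.≟ g ax x⊑z)))
isoSpec? (pval ax f) (pval az g) = no (λ ())
isoSpec? (pval ay f) (pval az g) = no (λ ())
isoSpec? (pval az f) (pval ax g) = no (λ ())
isoSpec? (pval az f) (pval ay g) = no (λ ())

data Minimal : Attr → Set where
  min-x : Minimal ax
  min-y : Minimal ay

DomAt : Attr → Set
DomAt r = Σ Attr (λ y → y ⊑ r)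

minimal-unique : ∀ {r} → Minimal r → (u v : DomAt r) → u ≡ v
minimal-unique min-x (ax , ⊑-refl) (ax , ⊑-refl) = refl
minimal-unique min-y (ay , ⊑-refl) (ay , ⊑-refl) = refl

minimal-iso : ∀ {r r'} → Minimal r → Minimal r' → ∀ f g → f r ⊑-refl ≡ g r' ⊑-refl → pval r f ≃ᵈ pval r' g
minimal-iso {r} {r'} m m' f g e = bij , vals , order
  where
  bij : DomAt r ⤖ DomAt r'
  bij = mk⤖ {to = λ _ → r' , ⊑-refl}
             ((λ {u} {v} _ → minimal-unique m u v) , λ v → (r , ⊑-refl) , λ _ → minimal-unique m' _ v)
  vals : (u : DomAt r) → f (proj₁ u) (proj₂ u) ≡ g r' ⊑-refl
  vals u with minimal-unique m u (r , ⊑-refl)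
  ... | refl = e
  order : (u v : DomAt r) → (proj₁ u ⊑ proj₁ v) ⇔ (r' ⊑ r')
  order u v with minimal-unique m u v
  ... | refl = mk⇔ (λ _ → ⊑-refl) (λ _ → ⊑-refl)

minimal-iso⁻ : ∀ {r r'} → Minimal r → Minimal r' → ∀ f g → pval r f ≃ᵈ pval r' g → f r ⊑-refl ≡ g r' ⊑-refl
minimal-iso⁻ {r} {r'} m m' f g (h , vals , _) with Bijection.to h (r , ⊑-refl) | vals (r , ⊑-refl)
... | u | e with minimal-unique m' u (r' , ⊑-refl)
... | refl = e

-- cl(z) has three elements, so it is in bijection with no singleton closure.
no-iso-z→minimal : ∀ {r} → Minimal r → ¬ (DomAt az ⤖ DomAt r)
no-iso-z→minimal m h with Bijection.injective h {ax , x⊑z} {az , ⊑-refl} (minimal-unique m _ _)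
... | ()

no-iso-minimal→z : ∀ {r} → Minimal r → ¬ (DomAt r ⤖ DomAt az)
no-iso-minimal→z m h with Bijection.surjective h (ax , x⊑z) | Bijection.surjective h (az , ⊑-refl)
... | (u , pu) | (v , pv) with trans (sym (pu refl)) (subst (λ t → Bijection.to h t ≡ (az , ⊑-refl)) (minimal-unique m v u) (pv refl))
... | ()

swapZ : DomAt az → DomAt az
swapZ (ax , x⊑z)   = ay , y⊑z
swapZ (ay , y⊑z)   = ax , x⊑z
swapZ (az , ⊑-refl) = az , ⊑-refl

swapZ-involutive : ∀ u → swapZ (swapZ u) ≡ u
swapZ-involutive (ax , x⊑z)   = refl
swapZ-involutive (ay , y⊑z)   = refl
swapZ-involutive (az , ⊑-refl) = refl

swapZ-bij : DomAt az ⤖ DomAt az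
swapZ-bij = mk⤖ {to = swapZ}
  ((λ {u} {v} e → trans (sym (swapZ-involutive u)) (trans (cong swapZ e) (swapZ-involutive v))) ,
   λ v → swapZ v , λ e → trans (cong swapZ e) (swapZ-involutive v))

swapZ-order : (u v : DomAt az) → (proj₁ u ⊑ proj₁ v) ⇔ (proj₁ (swapZ u) ⊑ proj₁ (swapZ v))
swapZ-order (ax , x⊑z)   (ax , x⊑z)   = mk⇔ (λ _ → ⊑-refl) (λ _ → ⊑-refl)
swapZ-order (ax , x⊑z)   (ay , y⊑z)   = mk⇔ (λ ()) (λ ())
swapZ-order (ax , x⊑z)   (az , ⊑-refl) = mk⇔ (λ _ → y⊑z) (λ _ → x⊑z)
swapZ-order (ay , y⊑z)   (ax , x⊑z)   = mk⇔ (λ ()) (λ ())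
swapZ-order (ay , y⊑z)   (ay , y⊑z)   = mk⇔ (λ _ → ⊑-refl) (λ _ → ⊑-refl)
swapZ-order (ay , y⊑z)   (az , ⊑-refl) = mk⇔ (λ _ → x⊑z) (λ _ → y⊑z)
swapZ-order (az , ⊑-refl) (ax , x⊑z)   = mk⇔ (λ ()) (λ ())
swapZ-order (az , ⊑-refl) (ay , y⊑z)   = mk⇔ (λ ()) (λ ())
swapZ-order (az , ⊑-refl) (az , ⊑-refl) = mk⇔ (λ _ → ⊑-refl) (λ _ → ⊑-refl)

spec→iso : ∀ d d' → IsoSpec d d' → d ≃ᵈ d'
spec→iso (pval ax f) (pval ax g) e = minimal-iso min-x min-x f g e
spec→iso (pval ax f) (pval ay g) e = minimal-iso min-x min-y f g e
spec→iso (pval ay f) (pval ax g) e = minimal-iso min-y min-x f g e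
spec→iso (pval ay f) (pval ay g) e = minimal-iso min-y min-y f g e
spec→iso (pval az f) (pval az g) (ez , inj₁ (ex , ey)) =
  mk⤖ {to = λ u → u} ((λ e → e) , λ v → v , λ e → e) , vals , λ u v → mk⇔ (λ p → p) (λ p → p)
  where
  vals : (u : DomAt az) → f (proj₁ u) (proj₂ u) ≡ g (proj₁ u) (proj₂ u)
  vals (ax , x⊑z)   = ex
  vals (ay , y⊑z)   = ey
  vals (az , ⊑-refl) = ez
spec→iso (pval az f) (pval az g) (ez , inj₂ (ex , ey)) = swapZ-bij , vals , swapZ-order
  where
  vals : (u : DomAt az) → f (proj₁ u) (proj₂ u) ≡ g (proj₁ (swapZ u)) (proj₂ (swapZ u))
  vals (ax , x⊑z)   = ex
  vals (ay , y⊑z)   = ey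
  vals (az , ⊑-refl) = ez

-- An order isomorphism of cl(z) maps z to z (x, y ⊑ z, and injectivity) and
-- hence fixes or swaps x and y; the values follow.
z-iso→spec : ∀ f g → pval az f ≃ᵈ pval az g → IsoSpec (pval az f) (pval az g)
z-iso→spec f g (h , vals , order) =
  sorted (to (ax , x⊑z)) (to (ay , y⊑z)) (to (az , ⊑-refl)) refl refl refl
         (Equivalence.to (order (ax , x⊑z) (az , ⊑-refl)) x⊑z)
         (Equivalence.to (order (ay , y⊑z) (az , ⊑-refl)) y⊑z)
  where
  to = Bijection.to h
  inj = Bijection.injective h
  val≡ : ∀ u {v} → to u ≡ v → f (proj₁ u) (proj₂ u) ≡ g (proj₁ v) (proj₂ v)
  val≡ u e = trans (vals u) (cong (λ v → g (proj₁ v) (proj₂ v)) e)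
  -- a, b, c are the images of x, y, z; the last two arguments say x, y ⊑ z is preserved.
  sorted : ∀ a b c → to (ax , x⊑z) ≡ a → to (ay , y⊑z) ≡ b → to (az , ⊑-refl) ≡ c →
           proj₁ a ⊑ proj₁ c → proj₁ b ⊑ proj₁ c → IsoSpec (pval az f) (pval az g)
  sorted (ax , x⊑z)    (ay , y⊑z) (az , ⊑-refl) ea eb ec _ _ = val≡ _ ec , inj₁ (val≡ _ ea , val≡ _ eb)
  sorted (ay , y⊑z)    (ax , x⊑z) (az , ⊑-refl) ea eb ec _ _ = val≡ _ ec , inj₂ (val≡ _ ea , val≡ _ eb)
  sorted (ax , x⊑z)    (ax , x⊑z) c ea eb ec _ _ with inj (trans ea (sym eb))
  ... | ()
  sorted (ay , y⊑z)    (ay , y⊑z) c ea eb ec _ _ with inj (trans ea (sym eb))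
  ... | ()
  sorted a (az , ⊑-refl) (az , ⊑-refl) ea eb ec _ _ with inj (trans eb (sym ec))
  ... | ()
  sorted (az , ⊑-refl) b (az , ⊑-refl) ea eb ec _ _ with inj (trans ea (sym ec))
  ... | ()
  sorted (ax , x⊑z)    b (ax , x⊑z) ea eb ec _ _ with inj (trans ea (sym ec))
  ... | ()
  sorted (ay , y⊑z)    b (ay , y⊑z) ea eb ec _ _ with inj (trans ea (sym ec))
  ... | ()
  sorted (az , ⊑-refl) b (ax , x⊑z) ea eb ec () _
  sorted (az , ⊑-refl) b (ay , y⊑z) ea eb ec () _

iso→spec : ∀ d d' → d ≃ᵈ d' → IsoSpec d d'
iso→spec (pval ax f) (pval ax g) i       = minimal-iso⁻ min-x min-x f g i
iso→spec (pval ax f) (pval ay g) i       = minimal-iso⁻ min-x min-y f g i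
iso→spec (pval ay f) (pval ax g) i       = minimal-iso⁻ min-y min-x f g i
iso→spec (pval ay f) (pval ay g) i       = minimal-iso⁻ min-y min-y f g i
iso→spec (pval az f) (pval az g) i       = z-iso→spec f g i
iso→spec (pval ax f) (pval az g) (h , _) = no-iso-minimal→z min-x h
iso→spec (pval ay f) (pval az g) (h , _) = no-iso-minimal→z min-y h
iso→spec (pval az f) (pval ax g) (h , _) = no-iso-z→minimal min-x h
iso→spec (pval az f) (pval ay g) (h , _) = no-iso-z→minimal min-y h

-- (3) Decidability of the list semantics, and derived connectives.

dec-below : ∀ r (P : (y : Attr) → y ⊑ r → Set) → (∀ y q → Dec (P y q)) → Dec (Σ Attr λ y → Σ (y ⊑ r) (P y))
dec-below ax P dec with dec ax ⊑-refl
... | yes p = yes (ax , ⊑-refl , p)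
... | no ¬p = no λ { (ax , ⊑-refl , p) → ¬p p }
dec-below ay P dec with dec ay ⊑-refl
... | yes p = yes (ay , ⊑-refl , p)
... | no ¬p = no λ { (ay , ⊑-refl , p) → ¬p p }
dec-below az P dec with dec ax x⊑z | dec ay y⊑z | dec az ⊑-refl
... | yes p  | _     | _     = yes (ax , x⊑z , p)
... | no _   | yes p | _     = yes (ay , y⊑z , p)
... | no _   | no _  | yes p = yes (az , ⊑-refl , p)
... | no ¬p₁ | no ¬p₂ | no ¬p₃ =
  no λ { (ax , x⊑z , p) → ¬p₁ p ; (ay , y⊑z , p) → ¬p₂ p ; (az , ⊑-refl , p) → ¬p₃ p }

module _ {k : ℕ} where
  private
    Pred = Cell k → List (Cell k) → Set

  until? : (P Q : Pred) → (∀ s r → Dec (P s r)) → (∀ s r → Dec (Q s r)) → ∀ s r → Dec (Until P Q s r)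
  until? P Q P? Q? s [] with Q? s []
  ... | yes q = yes (here q)
  ... | no ¬q = no λ { (here q) → ¬q q }
  until? P Q P? Q? s (s' ∷ r) with Q? s (s' ∷ r) | P? s (s' ∷ r) | until? P Q P? Q? s' r
  ... | yes q | _     | _     = yes (here q)
  ... | no ¬q | yes p | yes u = yes (step p u)
  ... | no ¬q | no ¬p | _     = no λ { (here q) → ¬q q ; (step p u) → ¬p p }
  ... | no ¬q | yes p | no ¬u = no λ { (here q) → ¬q q ; (step p u) → ¬u u }

  sat? : ∀ (s : Cell k) r d φ → Dec (Sat s r d φ)
  sat? s r d (letter a)  = proj₁ s FP.≟ a
  sat? s r d (neg φ)     = ¬? (sat? s r d φ)
  sat? s r d (conj φ ψ)  = sat? s r d φ ×-dec sat? s r d ψ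
  sat? s []       d (next φ) = no (λ ())
  sat? s (s' ∷ r) d (next φ) = sat? s' r d φ
  sat? s r d (until φ ψ) = until? _ _ (λ s r → sat? s r d φ) (λ s r → sat? s r d ψ) s r
  sat? s r d (down x φ)  = sat? s r (restrictFull (proj₂ s) x) φ
  sat? s r d (up x) with dec-below (root d) (λ y q → IsoSpec (restrictP d y q) (restrictFull (proj₂ s) x)) (λ y q → isoSpec? _ _)
  ... | yes (y , q , c) = yes (y , q , spec→iso _ _ c)
  ... | no ¬c = no λ (y , q , i) → ¬c (y , q , iso→spec _ _ i)

  stable : ∀ {s : Cell k} {r d} φ → ¬ ¬ Sat s r d φ → Sat s r d φ
  stable {s} {r} {d} φ ¬¬p with sat? s r d φ
  ... | yes p = p
  ... | no ¬p = ⊥-elim (¬¬p ¬p)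

module _ {k : ℕ} where
  true : Formula k
  true = neg (conj (up ax) (neg (up ax)))

  _∨_ _⇒_ : Formula k → Formula k → Formula k
  φ ∨ ψ = neg (conj (neg φ) (neg ψ))
  φ ⇒ ψ = neg (conj φ (neg ψ))

  eventually always : Formula k → Formula k
  eventually φ = until true φ
  always φ = neg (eventually (neg φ))

  ⋀ : (m : ℕ) → (Fin m → Formula k) → Formula k
  ⋀ zero    g = true
  ⋀ (suc m) g = conj (g zero) (⋀ m (g ∘ suc))

  module _ {s : Cell k} {r : List (Cell k)} {d : PVal} where
    true-i : Sat s r d true
    true-i (p , ¬p) = ¬p p

    ∨-l : ∀ φ ψ → Sat s r d φ → Sat s r d (φ ∨ ψ)
    ∨-l φ ψ p (¬p , _) = ¬p p
    ∨-r : ∀ φ ψ → Sat s r d ψ → Sat s r d (φ ∨ ψ)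
    ∨-r φ ψ q (_ , ¬q) = ¬q q
    ∨-e : ∀ φ ψ → Sat s r d (φ ∨ ψ) → Sat s r d φ ⊎ Sat s r d ψ
    ∨-e φ ψ h with sat? s r d φ | sat? s r d ψ
    ... | yes p | _     = inj₁ p
    ... | no _  | yes q = inj₂ q
    ... | no ¬p | no ¬q = ⊥-elim (h (¬p , ¬q))

    ⇒-e : ∀ φ ψ → Sat s r d (φ ⇒ ψ) → Sat s r d φ → Sat s r d ψ
    ⇒-e φ ψ h p = stable ψ (λ ¬q → h (p , ¬q))

    ⋀-e : ∀ m g → Sat s r d (⋀ m g) → ∀ i → Sat s r d (g i)
    ⋀-e (suc m) g (h , _) zero    = h
    ⋀-e (suc m) g (_ , t) (suc i) = ⋀-e m (g ∘ suc) t i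
    ⋀-i : ∀ m g → (∀ i → Sat s r d (g i)) → Sat s r d (⋀ m g)
    ⋀-i zero    g f = true-i
    ⋀-i (suc m) g f = f zero , ⋀-i m (g ∘ suc) (f ∘ suc)

  data Suffix : List (Cell k) → List (Cell k) → Set where
    suffix-refl : ∀ {L} → Suffix L L
    suffix-step : ∀ {L a W} → Suffix L W → Suffix L (a ∷ W)

  suffix-trans : ∀ {L M W} → Suffix L M → Suffix M W → Suffix L W
  suffix-trans p suffix-refl     = p
  suffix-trans p (suffix-step q) = suffix-step (suffix-trans p q)

  suffix-tail : ∀ {a L W} → Suffix (a ∷ L) W → Suffix L W
  suffix-tail = suffix-trans (suffix-step suffix-refl)

  suffix-++ : ∀ pre {L W} → Suffix (pre ++ L) W → Suffix L W
  suffix-++ []        s = s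
  suffix-++ (a ∷ pre) s = suffix-++ pre (suffix-tail s)

  suffix-++ʳ : ∀ pre {L} → Suffix L (pre ++ L)
  suffix-++ʳ []        = suffix-refl
  suffix-++ʳ (a ∷ pre) = suffix-step (suffix-++ʳ pre)

  length-suffix : ∀ {L W} → Suffix L W → length L ℕ.≤ length W
  length-suffix suffix-refl     = ℕP.≤-refl
  length-suffix (suffix-step s) = ℕP.m≤n⇒m≤1+n (length-suffix s)

  suffix-∷ : ∀ {L a W} → Suffix L (a ∷ W) → L ≡ a ∷ W ⊎ Suffix L W
  suffix-∷ suffix-refl     = inj₁ refl
  suffix-∷ (suffix-step s) = inj₂ s

  SatHead : PVal → Formula k → List (Cell k) → Set
  SatHead d φ = AtHead (λ s r → Sat s r d φ)

  always-e : ∀ {d s r t u} φ → Sat s r d (always φ) → Suffix (t ∷ u) (s ∷ r) → Sat t u d φ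
  always-e φ h suffix-refl = stable φ (λ ¬p → h (here ¬p))
  always-e {d} {s} {s' ∷ r} φ h (suffix-step q) = always-e {s = s'} {r} φ (λ u → h (step (true-i {s = s} {s' ∷ r} {d}) u)) q

  always-i : ∀ {d s r} φ → (∀ t u → Suffix (t ∷ u) (s ∷ r) → Sat t u d φ) → Sat s r d (always φ)
  always-i φ f (here ¬p) = ¬p (f _ _ suffix-refl)
  always-i {s = s} {s' ∷ r} φ f (step _ u) = always-i {s = s'} {r} φ (λ t v q → f t v (suffix-step q)) u

SamePair : Val → Val → Set
SamePair u v = (u ax ≡ v ax × u ay ≡ v ay) ⊎ (u ax ≡ v ay × u ay ≡ v ax)

module _ {k : ℕ} {s : Cell k} {r : List (Cell k)} (u : Val) where
  ↑xx-e : Sat s r (restrictFull u ax) (up ax) → u ax ≡ proj₂ s ax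
  ↑xx-e (ax , ⊑-refl , i) = iso→spec (restrictP (restrictFull u ax) ax ⊑-refl) (restrictFull (proj₂ s) ax) i
  ↑xx-i : u ax ≡ proj₂ s ax → Sat s r (restrictFull u ax) (up ax)
  ↑xx-i e = ax , ⊑-refl , spec→iso (restrictP (restrictFull u ax) ax ⊑-refl) (restrictFull (proj₂ s) ax) e

  ↑xy-e : Sat s r (restrictFull u ax) (up ay) → u ax ≡ proj₂ s ay
  ↑xy-e (ax , ⊑-refl , i) = iso→spec (restrictP (restrictFull u ax) ax ⊑-refl) (restrictFull (proj₂ s) ay) i
  ↑xy-i : u ax ≡ proj₂ s ay → Sat s r (restrictFull u ax) (up ay)
  ↑xy-i e = ax , ⊑-refl , spec→iso (restrictP (restrictFull u ax) ax ⊑-refl) (restrictFull (proj₂ s) ay) e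

  ↑yx-e : Sat s r (restrictFull u ay) (up ax) → u ay ≡ proj₂ s ax
  ↑yx-e (ay , ⊑-refl , i) = iso→spec (restrictP (restrictFull u ay) ay ⊑-refl) (restrictFull (proj₂ s) ax) i
  ↑yx-i : u ay ≡ proj₂ s ax → Sat s r (restrictFull u ay) (up ax)
  ↑yx-i e = ay , ⊑-refl , spec→iso (restrictP (restrictFull u ay) ay ⊑-refl) (restrictFull (proj₂ s) ax) e

  ↑zz-e : Sat s r (restrictFull u az) (up az) → u az ≡ proj₂ s az × SamePair u (proj₂ s)
  ↑zz-e (ax , x⊑z , i)   = ⊥-elim (iso→spec (restrictP (restrictFull u az) ax x⊑z) (restrictFull (proj₂ s) az) i)
  ↑zz-e (ay , y⊑z , i)   = ⊥-elim (iso→spec (restrictP (restrictFull u az) ay y⊑z) (restrictFull (proj₂ s) az) i)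
  ↑zz-e (az , ⊑-refl , i) = iso→spec (restrictP (restrictFull u az) az ⊑-refl) (restrictFull (proj₂ s) az) i
  ↑zz-i : u az ≡ proj₂ s az → SamePair u (proj₂ s) → Sat s r (restrictFull u az) (up az)
  ↑zz-i e same = az , ⊑-refl , spec→iso (restrictP (restrictFull u az) az ⊑-refl) (restrictFull (proj₂ s) az) (e , same)

module _ {k : ℕ} where
  private
    Pred = Cell k → List (Cell k) → Set

  UntilAt : Pred → Pred → List (Cell k) → Set
  UntilAt P Q = AtHead (Until P Q)

  data Along (Q : Pred) : List (Cell k) → List (Cell k) → Set where
    []  : ∀ {L} → Along Q [] L
    _∷_ : ∀ {a pre L} → Q a (pre ++ L) → Along Q pre L → Along Q (a ∷ pre) L

  along-cells : ∀ {G : Cell k → Set} pre {L} → All G pre → Along (λ a _ → G a) pre L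
  along-cells []        []       = []
  along-cells (a ∷ pre) (g ∷ gs) = g ∷ along-cells pre gs

  until-skip : ∀ {P Q : Pred} (G : Cell k → Set) → (∀ a t → Q a t → G a) →
               ∀ pre {L} → All (¬_ ∘ G) pre → UntilAt P Q (pre ++ L) → UntilAt P Q L
  until-skip G QG []              _          u          = u
  until-skip G QG (a ∷ [])        (¬g ∷ _)   (here q)   = ⊥-elim (¬g (QG _ _ q))
  until-skip G QG (a ∷ [])        {_ ∷ _} _  (step p u) = u
  until-skip G QG (a ∷ (b ∷ pre)) (¬g ∷ _)   (here q)   = ⊥-elim (¬g (QG _ _ q))
  until-skip G QG (a ∷ (b ∷ pre)) (_ ∷ ¬gs)  (step p u) = until-skip G QG (b ∷ pre) ¬gs u

  until-prefix : ∀ {P Q : Pred} pre {L} → Along P pre L → UntilAt P Q L → UntilAt P Q (pre ++ L)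
  until-prefix []              []       u = u
  until-prefix (a ∷ [])        {_ ∷ _} (p ∷ []) u = step p u
  until-prefix (a ∷ (b ∷ pre)) (p ∷ ps) u = step p (until-prefix (b ∷ pre) ps u)

  until-stop : ∀ {P Q : Pred} {s r} → Until P Q s r → ¬ P s r → Q s r
  until-stop (here q)   _  = q
  until-stop (step p _) ¬p = ⊥-elim (¬p p)

  until-view : ∀ {P Q : Pred} {s} L → Until P Q s L → Q s L ⊎ (P s L × UntilAt P Q L)
  until-view []      (here q)   = inj₁ q
  until-view (_ ∷ L) (here q)   = inj₁ q
  until-view (_ ∷ L) (step p u) = inj₂ (p , u)

  until-next : ∀ {P Q : Pred} {s} L → P s L → UntilAt P Q L → Until P Q s L
  until-next (_ ∷ L) p u = step p u

-- (4) Chains.  A counter value m is stored as a list of m valuations forming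
-- a path s₀ → v₁ → … → vₘ: the y-value of each element is the x-value of its
-- predecessor (of s₀ for the first one) and s₀, v₁, …, vₘ are distinct.

xvals : List Val → List Δ
xvals = map (λ e → e ax)

data Chain : Δ → List Val → Set where
  []  : ∀ {v} → Chain v []
  _∷_ : ∀ {v e es} → e ay ≡ v → Chain (e ax) es → Chain v (e ∷ es)

Path : Δ → List Val → Set
Path v es = Chain v es × Unique (v ∷ xvals es)

end : Δ → List Val → Δ
end v []       = v
end v (e ∷ es) = end (e ax) es

end-++ : ∀ v L₁ L₂ → end v (L₁ ++ L₂) ≡ end (end v L₁) L₂
end-++ v []       L₂ = refl
end-++ v (e ∷ L₁) L₂ = end-++ (e ax) L₁ L₂

end-xvals : ∀ v L L' → xvals L ≡ xvals L' → end v L ≡ end v L'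
end-xvals v []      []        eq = refl
end-xvals v (e ∷ L) (e' ∷ L') eq with LP.∷-injective eq
... | h , t rewrite h = end-xvals (e' ax) L L' t

end-∈ : ∀ v L → end v L ∈ (v ∷ xvals L)
end-∈ v []      = here refl
end-∈ v (e ∷ L) = there (end-∈ (e ax) L)

chain-last : ∀ v cs c → Chain v (cs ++ [ c ]) → c ay ≡ end v cs
chain-last v []       c (e ∷ _)  = e
chain-last v (d ∷ cs) c (_ ∷ ch) = chain-last (d ax) cs c ch

absent-chain : ∀ {v w cs} → Chain w cs → All (v ≢_) (w ∷ xvals cs) → All (λ c → v ≢ c ay × v ≢ c ax) cs
absent-chain []       _                  = []
absent-chain (e ∷ ch) (v≢w ∷ (v≢x ∷ rest)) = ((λ q → v≢w (trans q e)) , v≢x) ∷ absent-chain ch (v≢x ∷ rest)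

unique-prefix : ∀ M₁ {M₂ : List Δ} → Unique (M₁ ++ M₂) → Unique M₁
unique-prefix []       u        = []
unique-prefix (m ∷ M₁) (m∉ ∷ u) = AllP.++⁻ˡ M₁ m∉ ∷ unique-prefix M₁ u

disjoint-++ : ∀ M₁ {M₂} {a : Δ} → Unique (M₁ ++ M₂) → a ∈ M₁ → a ∈ M₂ → ⊥
disjoint-++ (m ∷ M₁) (m∉ ∷ _) (here refl) q = All.lookup m∉ (AnyP.++⁺ʳ M₁ q) refl
disjoint-++ (m ∷ M₁) (_ ∷ u)  (there p)   q = disjoint-++ M₁ u p q

-- Induction on
-- as₀: the first element e has y = v, and in bs only the first element has v
-- in its pair, so that element has the x-value of e.
chainPrefix : ∀ v as₀ as₁ bs → Path v (as₀ ++ as₁) → Path v bs → All (λ e → Any (SamePair e) bs) as₀ →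
              Σ (List Val) λ bs₀ → Σ (List Val) λ bs₁ → (bs ≡ bs₀ ++ bs₁) × (xvals bs₀ ≡ xvals as₀)
chainPrefix v []        as₁ bs       _ _ _ = [] , bs , refl , refl
chainPrefix v (e ∷ as₀) as₁ []       _ _ (() ∷ _)
chainPrefix v (e ∷ as₀) as₁ (b ∷ bs) (ey ∷ cha , (v∉ ∷ (e∉ ∷ ua))) (by ∷ chb , (v∉b ∷ (b∉ ∷ ub))) (me ∷ ms) =
  let bs₀ , bs₁ , eq , xeq = chainPrefix (e ax) as₀ as₁ bs (cha , (e∉ ∷ ua))
                               (subst (λ t → Path t bs) (sym ex≡bx) (chb , (b∉ ∷ ub))) (All.zipWith (λ {e₂} → notFirst {e₂}) (later , ms))
  in b ∷ bs₀ , bs₁ , cong (b ∷_) eq , cong₂ _∷_ (sym ex≡bx) xeq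
  where
  ex≡bx : e ax ≡ b ax
  ex≡bx = firstMatch me
    where
    firstMatch : Any (SamePair e) (b ∷ bs) → e ax ≡ b ax
    firstMatch (here (inj₁ (q , _))) = q
    firstMatch (here (inj₂ (q , _))) = ⊥-elim (All.head v∉ (sym (trans q by)))
    firstMatch (there m) with find m
    ... | c , c∈ , same with All.lookup (absent-chain chb v∉b) c∈ | same
    ...   | (v≢cy , _) | inj₁ (_ , q) = ⊥-elim (v≢cy (trans (sym ey) q))
    ...   | (_ , v≢cx) | inj₂ (_ , q) = ⊥-elim (v≢cx (trans (sym ey) q))
  later : All (λ e₂ → e ax ≢ e₂ ax × v ≢ e₂ ax) as₀
  later = All.zip (AllP.map⁻ (AllP.++⁻ˡ (xvals as₀) (subst (All _) (LP.map-++ _ as₀ as₁) e∉)) ,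
                   AllP.map⁻ (AllP.++⁻ˡ (xvals as₀) (subst (All _) (LP.map-++ _ as₀ as₁) (All.tail v∉))))
  notFirst : ∀ {e₂} → (e ax ≢ e₂ ax × v ≢ e₂ ax) × Any (SamePair e₂) (b ∷ bs) → Any (SamePair e₂) bs
  notFirst ((n₁ , _) , here (inj₁ (q , _))) = ⊥-elim (n₁ (trans ex≡bx (sym q)))
  notFirst ((_ , n₂) , here (inj₂ (q , _))) = ⊥-elim (n₂ (trans (sym by) (sym q)))
  notFirst (_ , there m) = m

no-extension : ∀ v bs₀ bs₁ → Unique (v ∷ xvals (bs₀ ++ bs₁)) → end v (bs₀ ++ bs₁) ≡ end v bs₀ → bs₁ ≡ []
no-extension v bs₀ []       u e = refl
no-extension v bs₀ (c ∷ cs) u e =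
  ⊥-elim (disjoint-++ (v ∷ xvals bs₀) (subst Unique (cong (v ∷_) (LP.map-++ _ bs₀ (c ∷ cs))) u) inPrefix (end-∈ (c ax) cs))
  where
  inPrefix : end (c ax) cs ∈ (v ∷ xvals bs₀)
  inPrefix = subst (_∈ (v ∷ xvals bs₀)) (trans (sym e) (end-++ v bs₀ (c ∷ cs))) (end-∈ v bs₀)

length-xvals : ∀ {L L'} → xvals L ≡ xvals L' → length L ≡ length L'
length-xvals {L} {L'} eq = trans (sym (LP.length-map _ L)) (trans (cong length eq) (LP.length-map _ L'))

length-snoc : ∀ (L : List Val) c → length (L ++ [ c ]) ≡ suc (length L)
length-snoc L c = trans (LP.length-++ L) (ℕP.+-comm (length L) 1)

snocView : ∀ (L : List Val) → L ≡ [] ⊎ Σ (List Val) λ cs → Σ Val λ c → L ≡ cs ++ [ c ]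
snocView []      = inj₁ refl
snocView (e ∷ L) with snocView L
... | inj₁ refl           = inj₂ ([] , e , refl)
... | inj₂ (cs , c , eq) = inj₂ (e ∷ cs , c , cong (e ∷_) eq)

split-snoc : ∀ (bs₀ bs₁ cs : List Val) c → bs₀ ++ bs₁ ≡ cs ++ [ c ] →
             (bs₁ ≡ [] × bs₀ ≡ cs ++ [ c ]) ⊎ Σ (List Val) λ b₁ → bs₁ ≡ b₁ ++ [ c ] × cs ≡ bs₀ ++ b₁
split-snoc []       bs₁       cs       c eq = inj₂ (cs , eq , refl)
split-snoc (b ∷ bs₀) []       cs       c eq = inj₁ (refl , trans (sym (LP.++-identityʳ (b ∷ bs₀))) eq)
split-snoc (b ∷ [])        (_ ∷ _) [] c ()
split-snoc (b ∷ (_ ∷ _))   (_ ∷ _) [] c ()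
split-snoc (b ∷ bs₀) (x ∷ bs₁) (d ∷ cs) c eq with LP.∷-injective eq
... | h , t with split-snoc bs₀ (x ∷ bs₁) cs c t
...   | inj₁ (() , _)
...   | inj₂ (b₁ , e₁ , e₂) = inj₂ (b₁ , e₁ , cong₂ _∷_ (sym h) e₂)

keep-length : ∀ v as as' → Path v as → Path v as' → All (λ e → Any (SamePair e) as') as →
              end v as' ≡ end v as → length as' ≡ length as
keep-length v as as' pa pa' cover ends
  with chainPrefix v as [] as' (subst (Path v) (sym (LP.++-identityʳ as)) pa) pa' cover
... | bs₀ , bs₁ , refl , xeq with no-extension v bs₀ bs₁ (proj₂ pa') (trans ends (end-xvals v as bs₀ (sym xeq)))
...   | refl = trans (cong length (LP.++-identityʳ bs₀)) (length-xvals xeq)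

inc-length : ∀ v as cs c → Path v as → Path v (cs ++ [ c ]) → All (λ e → Any (SamePair e) (cs ++ [ c ])) as →
             c ay ≡ end v as → length (cs ++ [ c ]) ≡ suc (length as)
inc-length v as cs c pa pa'@(ch' , u') cover cy
  with chainPrefix v as [] (cs ++ [ c ]) (subst (Path v) (sym (LP.++-identityʳ as)) pa) pa' cover
... | bs₀ , bs₁ , eq , xeq with split-snoc bs₀ bs₁ cs c (sym eq)
...   | inj₁ (_ , refl) = ⊥-elim (disjoint-++ (v ∷ xvals cs) u'' cx∈ (here refl))
  where
  u'' = subst Unique (cong (v ∷_) (LP.map-++ _ cs [ c ])) u'
  -- c ay is both the end of cs and (through bs₀ = cs ++ [ c ]) equal to c ax.
  cx∈ : c ax ∈ (v ∷ xvals cs)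
  cx∈ = subst (_∈ (v ∷ xvals cs))
              (trans (sym (chain-last v cs c ch')) (trans cy (trans (end-xvals v as (cs ++ [ c ]) (sym xeq)) (end-++ v cs [ c ]))))
              (end-∈ v cs)
...   | inj₂ (b₁ , refl , refl)
  with no-extension v bs₀ b₁ (unique-prefix (v ∷ xvals (bs₀ ++ b₁)) (subst Unique (cong (v ∷_) (LP.map-++ _ (bs₀ ++ b₁) [ c ])) u'))
                    (trans (sym (chain-last v (bs₀ ++ b₁) c ch')) (trans cy (end-xvals v as bs₀ (sym xeq))))
...     | refl = trans (length-snoc (bs₀ ++ []) c) (cong suc (trans (cong length (LP.++-identityʳ bs₀)) (length-xvals xeq)))

dec-length : ∀ v as₀ el as' → Path v (as₀ ++ [ el ]) → Path v as' → All (λ e → Any (SamePair e) as') as₀ →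
             end v as' ≡ el ay → suc (length as') ≡ length (as₀ ++ [ el ])
dec-length v as₀ el as' pa pa' cover ends with chainPrefix v as₀ [ el ] as' pa pa' cover
... | bs₀ , bs₁ , refl , xeq
  with no-extension v bs₀ bs₁ (proj₂ pa') (trans ends (trans (chain-last v as₀ el (proj₁ pa)) (end-xvals v as₀ bs₀ (sym xeq))))
...   | refl = trans (cong suc (trans (cong length (LP.++-identityʳ bs₀)) (length-xvals xeq))) (sym (length-snoc as₀ el))

other : Ctr → Ctr
other c₁ = c₂
other c₂ = c₁

counter : ∀ {m} → Ctr → Config m → ℕ
counter c₁ x = proj₁ (proj₂ x)
counter c₂ x = proj₂ (proj₂ x)

module _ {m : ℕ} {P : Fin m → Instr m} where
  inc-step : ∀ c {j} {x y : Config m} → P (proj₁ x) ≡ INC c j → proj₁ y ≡ j →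
             counter c y ≡ suc (counter c x) → counter (other c) y ≡ counter (other c) x → Step P x y
  inc-step c₁ {x = _ , _ , _} {_ , _ , _} eq refl refl refl = inc₁ eq
  inc-step c₂ {x = _ , _ , _} {_ , _ , _} eq refl refl refl = inc₂ eq

  dec-zero-step : ∀ c {j l} {x y : Config m} → P (proj₁ x) ≡ DEC c j l → proj₁ y ≡ l →
                  counter c x ≡ 0 → counter c y ≡ 0 → counter (other c) y ≡ counter (other c) x → Step P x y
  dec-zero-step c₁ {x = _ , _ , _} {_ , _ , _} eq refl refl refl refl = dec₁z eq
  dec-zero-step c₂ {x = _ , _ , _} {_ , _ , _} eq refl refl refl refl = dec₂z eq

  dec-suc-step : ∀ c {j l} {x y : Config m} → P (proj₁ x) ≡ DEC c j l → proj₁ y ≡ j →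
                 suc (counter c y) ≡ counter c x → counter (other c) y ≡ counter (other c) x → Step P x y
  dec-suc-step c₁ {x = _ , _ , _} {_ , _ , _} eq refl refl refl = dec₁s eq
  dec-suc-step c₂ {x = _ , _ , _} {_ , _ , _} eq refl refl refl = dec₂s eq

-- (5) The formula Φ of a machine with instructions P.
module Encoding (n : ℕ) (P : Fin (suc n) → Instr (suc n)) where

  -- Letters: a and b for counter units, k between the two runs, h_i for instruction i.
  Letters : ℕ
  Letters = suc (suc (suc (suc n)))

  Fm : Set
  Fm = Formula Letters

  Cl : Set
  Cl = Cell Letters

  la lk lb : Fin Letters
  la = zero
  lk = suc zero
  lb = suc (suc zero)

  lh : Fin (suc n) → Fin Letters
  lh i = suc (suc (suc i))

  ctr : Ctr → Fin Letters
  ctr c₁ = la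
  ctr c₂ = lb

  A K B isH ux uy uz : Fm
  A   = letter la
  K   = letter lk
  B   = letter lb
  isH = conj (neg A) (conj (neg K) (neg B))
  ux  = up ax
  uy  = up ay
  uz  = up az

  atNextH atK : Fm → Fm
  atNextH φ = next (until (neg isH) (conj isH φ))
  atK φ     = until (neg K) (conj K φ)

  Run : Ctr → Fm
  Run c = letter (ctr c)

  -- From the h-cell of a block to the cell preceding the run of counter c.
  toStart : Ctr → Fm → Fm
  toStart c₁ φ = φ
  toStart c₂ φ = atK φ

  -- From the h-cell of a block, find a cell of the run of c carrying the
  -- stored z-value and {x,y}-pair.
  seek : Ctr → Fm
  seek c₁ = until (neg K) (conj A uz)
  seek c₂ = atK (until (neg isH) (conj B uz))

  -- The current cell of the run of c reappears in the run of c of the next block.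
  copied : Ctr → Fm
  copied c = down az (until (neg isH) (conj isH (seek c)))

  -- Every cell of the run is copied; every cell but the last one is.
  allCopied allButLastCopied : Ctr → Fm
  allCopied c        = toStart c (neg (next (until (Run c) (conj (Run c) (neg (copied c))))))
  allButLastCopied c = toStart c (neg (next (until (Run c) (conj (Run c) (conj (next (Run c)) (neg (copied c)))))))

  -- φ at the last cell of the run of c (or the cell preceding an empty run).
  atLast : Ctr → Fm → Fm
  atLast c₁ φ = until (neg K) (conj (next K) φ)
  atLast c₂ φ = atK (until (neg isH) (conj (neg isH) (conj (neg (next B)) φ)))

  -- Store attribute att of the last cell of the run of c and test cond at the
  -- last cell of the run of c in the next block.
  compareLast : Ctr → Attr → Fm → Fm
  compareLast c att cond = atLast c (down att (atNextH (atLast c cond)))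

  Keep Incr Decr Zero Pos : Ctr → Fm
  Keep c = conj (allCopied c) (compareLast c ax ux)
  Incr c = conj (allCopied c) (compareLast c ax (conj (Run c) uy))
  Decr c = conj (allButLastCopied c) (compareLast c ay ux)
  Zero c = toStart c (neg (next (Run c)))
  Pos c  = toStart c (next (Run c))

  zeroBranch posBranch : Ctr → Fin (suc n) → Fm
  zeroBranch c l = conj (Zero c) (conj (atNextH (letter (lh l))) (conj (Keep c) (Keep (other c))))
  posBranch c j  = conj (Pos c) (conj (atNextH (letter (lh j))) (conj (Decr c) (Keep (other c))))

  transition : Instr (suc n) → Fm
  transition (INC c j)   = conj (atNextH (letter (lh j))) (conj (Incr c) (Keep (other c)))
  transition (DEC c j l) = zeroBranch c l ∨ posBranch c j
  transition HALT        = true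

  -- The y-value of a following a/b-cell is the current x-value.
  linked : Fm
  linked = down ax (neg (next (neg ((A ∨ B) ⇒ uy))))

  -- At a cell of the run of c, no later cell of that run repeats its x-value.
  distinct : Ctr → Fm
  distinct c = Run c ⇒ down ax (neg (next (until (Run c) (conj (Run c) ux))))

  -- Invariants required at every position:
  --   Shape:   the word is a sequence of blocks h a* k b*;
  --   Links:   runs are chains with distinct x-values;
  --   Program: an h_i-cell performs instruction i.
  Shape Links Program Invariant : Fm
  Shape   = conj (isH ⇒ next (A ∨ K)) (conj (A ⇒ next (A ∨ K)) ((K ∨ B) ⇒ neg (next (A ∨ K))))
  Links   = conj linked (conj (distinct c₁) (distinct c₂))
  Program = ⋀ (suc n) (λ i → letter (lh i) ⇒ transition (P i))
  Invariant = conj Shape (conj Links Program)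

  -- Start in instruction 0 with both counters zero; h- and k-cells carry the
  -- x-value s₀ of the first cell, a- and b-cells never do.
  Initial SepMarked SepAvoided Φ : Fm
  Initial    = conj (letter (lh zero)) (next (conj K (neg (next B))))
  SepMarked  = down ax (always ((isH ∨ K) ⇒ ux))
  SepAvoided = down ax (always ((A ∨ B) ⇒ neg ux))
  Φ = conj Initial (conj SepMarked (conj SepAvoided (always Invariant)))

  -- (5') Cells of encoded runs, and how the formulas move along them.
  cell : Fin Letters → Val → Cl
  cell ℓ v = ℓ , v

  run : Fin Letters → List Val → List Cl
  run ℓ = map (cell ℓ)

  hcell : Fin (suc n) → Val → Cl
  hcell i = cell (lh i)

  lh-injective : ∀ {i j} → lh i ≡ lh j → i ≡ j
  lh-injective refl = refl

  all-run : ∀ {G : Cl → Set} ℓ → (∀ {v} → G (cell ℓ v)) → ∀ vs → All G (run ℓ vs)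
  all-run ℓ g vs = AllP.map⁺ (All.universal (λ _ → g) vs)

  record Block : Set where
    constructor block
    field
      pc : Fin (suc n)
      hv : Val
      as : List Val
      kv : Val
      bs : List Val
  open Block

  _▸_ : Block → List Cl → List Cl
  c ▸ rest = hcell (pc c) (hv c) ∷ (run la (as c) ++ cell lk (kv c) ∷ (run lb (bs c) ++ rest))

  config : Block → Config (suc n)
  config c = pc c , length (as c) , length (bs c)

  BlockEnd : List Cl → Set
  BlockEnd rest = rest ≡ [] ⊎ Σ (Fin (suc n)) λ i → Σ Val λ v → Σ (List Cl) λ u → rest ≡ hcell i v ∷ u

  lastCell : Fin Letters → Cl → List Val → Cl
  lastCell ℓ s []       = s
  lastCell ℓ s (e ∷ es) = lastCell ℓ (cell ℓ e) es

  lastCell-x : ∀ ℓ s es → proj₂ (lastCell ℓ s es) ax ≡ end (proj₂ s ax) es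
  lastCell-x ℓ s []       = refl
  lastCell-x ℓ s (e ∷ es) = lastCell-x ℓ (cell ℓ e) es

  lastCell-snoc : ∀ ℓ s cs c → lastCell ℓ s (cs ++ [ c ]) ≡ cell ℓ c
  lastCell-snoc ℓ s []       c = refl
  lastCell-snoc ℓ s (d ∷ cs) c = lastCell-snoc ℓ (cell ℓ d) cs c

  IsH : Cl → Set
  IsH s = Σ (Fin (suc n)) λ i → proj₁ s ≡ lh i

  isH-h : ∀ {i v r d} → Sat (hcell i v) r d isH
  isH-h = (λ ()) , (λ ()) , (λ ())

  isH→IsH : ∀ {s r d} → Sat s r d isH → IsH s
  isH→IsH {zero , _}                (¬a , _)      = ⊥-elim (¬a refl)
  isH→IsH {suc zero , _}            (_ , ¬k , _)  = ⊥-elim (¬k refl)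
  isH→IsH {suc (suc zero) , _}      (_ , _ , ¬b)  = ⊥-elim (¬b refl)
  isH→IsH {suc (suc (suc i)) , _}   _             = i , refl

  ¬isH : ∀ {s r d} → ¬ IsH s → ¬ Sat s r d isH
  ¬isH {s} {r} {d} ¬h h = ¬h (isH→IsH {s} {r} {d} h)

  ¬IsH-k : ∀ {v} → ¬ IsH (cell lk v)
  ¬IsH-k (_ , ())

  ¬IsH-ctr : ∀ c {v} → ¬ IsH (cell (ctr c) v)
  ¬IsH-ctr c₁ (_ , ())
  ¬IsH-ctr c₂ (_ , ())

  ¬IsH-run : ∀ c vs → All (¬_ ∘ IsH) (run (ctr c) vs)
  ¬IsH-run c = all-run (ctr c) (λ {v} → ¬IsH-ctr c {v})

  UntilH : PVal → Fm → List Cl → Set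
  UntilH d φ = UntilAt (λ s r → Sat s r d (neg isH)) (λ s r → Sat s r d (conj isH φ))

  skipToH : ∀ {d} φ pre {L} → All (¬_ ∘ IsH) pre → UntilH d φ (pre ++ L) → UntilH d φ L
  skipToH {d} φ pre ¬h u = until-skip IsH (λ a t q → isH→IsH {a} {t} {d} (proj₁ q)) pre ¬h u

  atH-e : ∀ {d} φ {i v u} → UntilH d φ (hcell i v ∷ u) → Sat (hcell i v) u d φ
  atH-e {d} φ {i} {v} {u} h = proj₂ (until-stop h (λ ¬h → ¬h (isH-h {i} {v} {u} {d})))

  prefixToH : ∀ {d} φ pre {L} → All (¬_ ∘ IsH) pre → UntilH d φ L → UntilH d φ (pre ++ L)
  prefixToH {d} φ pre ¬h u = until-prefix pre (along-cells pre (All.map (λ {s} ¬hs → ¬isH {s} {[]} {d} ¬hs) ¬h)) u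

  atH-i : ∀ {d} φ {i v u} → Sat (hcell i v) u d φ → UntilH d φ (hcell i v ∷ u)
  atH-i {d} φ {i} {v} {u} h = here (isH-h {i} {v} {u} {d} , h)

  atK-e : ∀ {d} φ i v as kv R →
          Until (λ s r → Sat s r d (neg K)) (λ s r → Sat s r d (conj K φ)) (hcell i v) (run la as ++ cell lk kv ∷ R) →
          Sat (cell lk kv) R d φ
  atK-e {d} φ i v as kv R u =
    proj₂ (until-stop (until-skip (λ s → proj₁ s ≡ lk) (λ a t q → proj₁ q) (hcell i v ∷ run la as)
                                  ((λ ()) ∷ all-run la (λ ()) as) u)
                      (λ ¬k → ¬k refl))

  atK-i : ∀ {d} φ i v as kv R → Sat (cell lk kv) R d φ →
          Until (λ s r → Sat s r d (neg K)) (λ s r → Sat s r d (conj K φ)) (hcell i v) (run la as ++ cell lk kv ∷ R)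
  atK-i {d} φ i v as kv R h =
    until-prefix (hcell i v ∷ run la as) (along-cells (hcell i v ∷ run la as) ((λ ()) ∷ all-run la (λ ()) as)) (here (refl , h))

  atLast₁-e : ∀ {d} φ s as kv R → ¬ AtHead (λ t _ → proj₁ t ≡ lk) R →
              Until (λ s r → Sat s r d (neg K)) (λ s r → Sat s r d (conj (next K) φ)) s (run la as ++ cell lk kv ∷ R) →
              Sat (lastCell la s as) (cell lk kv ∷ R) d φ
  atLast₁-e φ s []       kv R ¬k (here (_ , q))              = q
  atLast₁-e φ s []       kv R ¬k (step _ (here (k , _)))     = ⊥-elim (¬k k)
  atLast₁-e φ s []       kv R ¬k (step _ (step ¬k' _))       = ⊥-elim (¬k' refl)
  atLast₁-e φ s (e ∷ as) kv R ¬k (here (() , _))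
  atLast₁-e φ s (e ∷ as) kv R ¬k (step _ u)                  = atLast₁-e φ (cell la e) as kv R ¬k u

  atLast₁-i : ∀ {d} φ s as kv R → ¬ (proj₁ s ≡ lk) → Sat (lastCell la s as) (cell lk kv ∷ R) d φ →
              Until (λ s r → Sat s r d (neg K)) (λ s r → Sat s r d (conj (next K) φ)) s (run la as ++ cell lk kv ∷ R)
  atLast₁-i φ s []       kv R ¬k h = here (refl , h)
  atLast₁-i φ s (e ∷ as) kv R ¬k h = step ¬k (atLast₁-i φ (cell la e) as kv R (λ ()) h)

  UntilLast₂ : PVal → Fm → Cl → List Cl → Set
  UntilLast₂ d φ = Until (λ s r → Sat s r d (neg isH)) (λ s r → Sat s r d (conj (neg isH) (conj (neg (next B)) φ)))

  atLast₂-e : ∀ {d} φ s bs rest → BlockEnd rest → UntilLast₂ d φ s (run lb bs ++ rest) → Sat (lastCell lb s bs) rest d φ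
  atLast₂-e φ s [] rest fin u with until-view rest u
  ... | inj₁ (_ , _ , q) = q
  atLast₂-e {d} φ s [] _ (inj₂ (i , v , w , refl)) u | inj₂ (_ , here (¬h , _)) = ⊥-elim (¬h (isH-h {i} {v} {w} {d}))
  atLast₂-e {d} φ s [] _ (inj₂ (i , v , w , refl)) u | inj₂ (_ , step ¬h _)     = ⊥-elim (¬h (isH-h {i} {v} {w} {d}))
  atLast₂-e φ s [] _ (inj₁ refl) u | inj₂ (_ , ())
  atLast₂-e φ s (e ∷ bs) rest fin u with until-view (cell lb e ∷ (run lb bs ++ rest)) u
  ... | inj₁ (_ , ¬b , _) = ⊥-elim (¬b refl)
  ... | inj₂ (_ , u')     = atLast₂-e φ (cell lb e) bs rest fin u'

  atLast₂-i : ∀ {d} φ s bs rest → ¬ Sat s [] d isH → BlockEnd rest → Sat (lastCell lb s bs) rest d φ →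
              UntilLast₂ d φ s (run lb bs ++ rest)
  atLast₂-i φ s [] _ ¬h (inj₁ refl) h                  = here (¬h , (λ ()) , h)
  atLast₂-i φ s [] _ ¬h (inj₂ (i , v , u , refl)) h    = here (¬h , (λ ()) , h)
  atLast₂-i {d} φ s (e ∷ bs) rest ¬h fin h = step ¬h (atLast₂-i φ (cell lb e) bs rest (¬isH {cell lb e} {[]} {d} (¬IsH-ctr c₂ {e})) fin h)

  UpZ : PVal → Val → Set
  UpZ ρ e = Sat (cell la e) [] ρ uz

  find₁ : ∀ {ρ i v} as kv R →
          Until (λ s r → Sat s r ρ (neg K)) (λ s r → Sat s r ρ (conj A uz)) (hcell i v) (run la as ++ cell lk kv ∷ R) →
          Any (UpZ ρ) as
  find₁ {ρ} as kv R u with until-view (run la as ++ cell lk kv ∷ R) u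
  ... | inj₁ (() , _)
  ... | inj₂ (_ , u') = walk as u'
    where
    walk : ∀ as → UntilAt (λ s r → Sat s r ρ (neg K)) (λ s r → Sat s r ρ (conj A uz)) (run la as ++ cell lk kv ∷ R) → Any (UpZ ρ) as
    walk []       (here (() , _))
    walk []       (step ¬k _) = ⊥-elim (¬k refl)
    walk (e ∷ as) u with until-view (run la as ++ cell lk kv ∷ R) u
    ... | inj₁ (_ , q)  = here q
    ... | inj₂ (_ , u') = there (walk as u')

  find₂ : ∀ {ρ} kv bs rest → BlockEnd rest →
          Until (λ s r → Sat s r ρ (neg isH)) (λ s r → Sat s r ρ (conj B uz)) (cell lk kv) (run lb bs ++ rest) →
          Any (UpZ ρ) bs
  find₂ {ρ} kv bs rest fin u with until-view (run lb bs ++ rest) u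
  ... | inj₁ (() , _)
  ... | inj₂ (_ , u') = walk bs fin u'
    where
    walk : ∀ bs {rest} → BlockEnd rest → UntilAt (λ s r → Sat s r ρ (neg isH)) (λ s r → Sat s r ρ (conj B uz)) (run lb bs ++ rest) →
           Any (UpZ ρ) bs
    walk [] (inj₁ refl) ()
    walk [] (inj₂ (i , v , w , refl)) (here (() , _))
    walk [] (inj₂ (i , v , w , refl)) (step ¬h _) = ⊥-elim (¬h (isH-h {i} {v} {w} {ρ}))
    walk (e ∷ bs) {rest} fin u with until-view (run lb bs ++ rest) u
    ... | inj₁ (_ , q)  = here q
    ... | inj₂ (_ , u') = there (walk bs fin u')

  UntilRun : Fin Letters → PVal → Fm → List Cl → Set
  UntilRun ℓ d χ = UntilAt (λ s r → Sat s r d (letter ℓ)) (λ s r → Sat s r d (conj (letter ℓ) χ))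

  run-none : ∀ {d} ℓ χ vs R → ¬ UntilRun ℓ d χ (run ℓ vs ++ R) → Along (λ a t → ¬ Sat a t d χ) (run ℓ vs) R
  run-none ℓ χ []       R h = []
  run-none ℓ χ (e ∷ vs) R h =
    (λ x → h (here (refl , x))) ∷ run-none ℓ χ vs R (λ u → h (until-next (run ℓ vs ++ R) refl u))

  run-none⁻ : ∀ {d} ℓ χ vs R → ¬ AtHead (λ s _ → proj₁ s ≡ ℓ) R → Along (λ a t → ¬ Sat a t d χ) (run ℓ vs) R →
              ¬ UntilRun ℓ d χ (run ℓ vs ++ R)
  run-none⁻ ℓ χ []       (_ ∷ R) ¬ℓ [] (here (l , _)) = ¬ℓ l
  run-none⁻ ℓ χ []       (_ ∷ R) ¬ℓ [] (step l _)     = ¬ℓ l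
  run-none⁻ ℓ χ (e ∷ vs) R ¬ℓ (¬χ ∷ ¬χs) u with until-view (run ℓ vs ++ R) u
  ... | inj₁ (_ , x)  = ¬χ x
  ... | inj₂ (_ , u') = run-none⁻ ℓ χ vs R ¬ℓ ¬χs u'

  run-distinct : ∀ ℓ e post R → ¬ UntilRun ℓ (restrictFull e ax) ux (run ℓ post ++ R) → All (λ e' → e ax ≢ e' ax) post
  run-distinct ℓ e []          R h = []
  run-distinct ℓ e (e' ∷ post) R h =
    (λ eq → h (here (refl , ↑xx-i {s = cell ℓ e'} {run ℓ post ++ R} e eq))) ∷
    run-distinct ℓ e post R (λ u → h (until-next (run ℓ post ++ R) refl u))

  along-run : ∀ {Q : Cl → List Cl → Set} {X : Val → Set} ℓ vs R →
              (∀ e post → Q (cell ℓ e) (run ℓ post ++ R) → X e) → Along Q (run ℓ vs) R → All X vs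
  along-run ℓ []       R f []       = []
  along-run ℓ (e ∷ vs) R f (q ∷ qs) = f e vs q ∷ along-run ℓ vs R f qs

  runOf : Ctr → Block → List Val
  runOf c₁ = as
  runOf c₂ = bs

  startCell : Ctr → Block → Cl
  startCell c₁ c = hcell (pc c) (hv c)
  startCell c₂ c = cell lk (kv c)

  between : Ctr → Block → List Cl
  between c₁ c = cell lk (kv c) ∷ run lb (bs c)
  between c₂ c = []

  body : Block → List Cl → List Cl
  body c rest = run la (as c) ++ cell lk (kv c) ∷ (run lb (bs c) ++ rest)

  fromStart : Ctr → Block → List Cl → List Cl
  fromStart k c rest = run (ctr k) (runOf k c) ++ (between k c ++ rest)

  counter-config : ∀ k c → counter k (config c) ≡ length (runOf k c)
  counter-config c₁ c = refl
  counter-config c₂ c = refl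

  start-suffix : ∀ k c rest → Suffix (startCell k c ∷ fromStart k c rest) (c ▸ rest)
  start-suffix c₁ c rest = suffix-refl
  start-suffix c₂ c rest = suffix-++ʳ (hcell (pc c) (hv c) ∷ run la (as c))

  ¬IsH-between : ∀ k c → All (¬_ ∘ IsH) (between k c)
  ¬IsH-between c₁ c = ¬IsH-k {kv c} ∷ ¬IsH-run c₂ (bs c)
  ¬IsH-between c₂ c = []

  run-ends : ∀ k c c' rest → ¬ AtHead (λ s _ → proj₁ s ≡ ctr k) (between k c ++ (c' ▸ rest))
  run-ends c₁ c c' rest ()
  run-ends c₂ c c' rest ()

  toStart-e : ∀ {d} k φ c rest → Sat (hcell (pc c) (hv c)) (body c rest) d (toStart k φ) →
              Sat (startCell k c) (fromStart k c rest) d φ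
  toStart-e c₁ φ c rest h = h
  toStart-e c₂ φ c rest h = atK-e φ (pc c) (hv c) (as c) (kv c) (run lb (bs c) ++ rest) h

  toStart-i : ∀ {d} k φ c rest → Sat (startCell k c) (fromStart k c rest) d φ →
              Sat (hcell (pc c) (hv c)) (body c rest) d (toStart k φ)
  toStart-i c₁ φ c rest h = h
  toStart-i c₂ φ c rest h = atK-i φ (pc c) (hv c) (as c) (kv c) (run lb (bs c) ++ rest) h

  last₂ : Fm → Fm
  last₂ φ = until (neg isH) (conj (neg isH) (conj (neg (next B)) φ))

  lastOf : Ctr → Block → Cl
  lastOf k c = lastCell (ctr k) (startCell k c) (runOf k c)

  atLast-e : ∀ {d} k φ c rest → BlockEnd rest → Sat (hcell (pc c) (hv c)) (body c rest) d (atLast k φ) →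
             Sat (lastOf k c) (between k c ++ rest) d φ
  atLast-e c₁ φ c rest fin h = atLast₁-e φ (hcell (pc c) (hv c)) (as c) (kv c) (run lb (bs c) ++ rest) (¬k (bs c) fin) h
    where
    ¬k : ∀ bs {rest} → BlockEnd rest → ¬ AtHead (λ t _ → proj₁ t ≡ lk) (run lb bs ++ rest)
    ¬k (_ ∷ _) _                         ()
    ¬k []      (inj₁ refl)               ()
    ¬k []      (inj₂ (_ , _ , _ , refl)) ()
  atLast-e {d} c₂ φ c rest fin h = atLast₂-e φ (cell lk (kv c)) (bs c) rest fin (atK-e {d} (last₂ φ) (pc c) (hv c) (as c) (kv c) (run lb (bs c) ++ rest) h)

  atLast-i : ∀ {d} k φ c rest → BlockEnd rest → Sat (lastOf k c) (between k c ++ rest) d φ →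
             Sat (hcell (pc c) (hv c)) (body c rest) d (atLast k φ)
  atLast-i c₁ φ c rest fin h = atLast₁-i φ (hcell (pc c) (hv c)) (as c) (kv c) (run lb (bs c) ++ rest) (λ ()) h
  atLast-i {d} c₂ φ c rest fin h =
    atK-i {d} (last₂ φ) (pc c) (hv c) (as c) (kv c) (run lb (bs c) ++ rest)
          (atLast₂-i φ (cell lk (kv c)) (bs c) rest (¬isH {cell lk (kv c)} {[]} {d} (¬IsH-k {kv c})) fin h)

  seek-e : ∀ {ρ} k c rest → BlockEnd rest → Sat (hcell (pc c) (hv c)) (body c rest) ρ (seek k) → Any (UpZ ρ) (runOf k c)
  seek-e {ρ} c₁ c rest fin h = find₁ {ρ} (as c) (kv c) (run lb (bs c) ++ rest) h
  seek-e {ρ} c₂ c rest fin h = find₂ {ρ} (kv c) (bs c) rest fin (atK-e {ρ} (until (neg isH) (conj B uz)) (pc c) (hv c) (as c) (kv c) (run lb (bs c) ++ rest) h)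

  -- (6) Soundness: a model of Φ is parsed into a halting run of the machine.
  module Soundness (w₀ : Cl) (W₀ : List Cl) (d₀ : PVal) (model : Sat w₀ W₀ d₀ Φ) where
    W : List Cl
    W = w₀ ∷ W₀

    inv : ∀ {t u} → Suffix (t ∷ u) W → Sat t u d₀ Invariant
    inv {t} {u} sf = always-e {d = d₀} {s = w₀} {r = W₀} {t = t} {u = u} Invariant (proj₂ (proj₂ (proj₂ model))) sf

    afterH : ∀ {i v r} → Suffix (hcell i v ∷ r) W → SatHead d₀ (A ∨ K) r
    afterH {i} {v} {r} sf = ⇒-e {s = hcell i v} {r = r} {d = d₀} isH (next (A ∨ K)) (proj₁ (proj₁ (inv sf))) (isH-h {i} {v} {r} {d₀})

    afterA : ∀ {v r} → Suffix (cell la v ∷ r) W → SatHead d₀ (A ∨ K) r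
    afterA {v} {r} sf = ⇒-e {s = cell la v} {r = r} {d = d₀} A (next (A ∨ K)) (proj₁ (proj₂ (proj₁ (inv sf)))) refl

    afterKB : ∀ {t r} → Suffix (t ∷ r) W → Sat t r d₀ (K ∨ B) → ¬ SatHead d₀ (A ∨ K) r
    afterKB {t} {r} sf kb = ⇒-e {s = t} {r = r} {d = d₀} (K ∨ B) (neg (next (A ∨ K))) (proj₂ (proj₂ (proj₁ (inv sf)))) kb

    blockSuffix : ∀ c rest → Suffix (c ▸ rest) W → Suffix rest W
    blockSuffix c rest sf = suffix-++ (cell lk (kv c) ∷ run lb (bs c)) (suffix-++ (hcell (pc c) (hv c) ∷ run la (as c)) sf)

    scanA : ∀ r → Suffix r W → SatHead d₀ (A ∨ K) r →
            Σ (List Val) λ as → Σ Val λ kv → Σ (List Cl) λ r' → r ≡ run la as ++ cell lk kv ∷ r'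
    scanA ((zero , v) ∷ r') sf h with scanA r' (suffix-tail sf) (afterA sf)
    ... | as , kv , r'' , eq = v ∷ as , kv , r'' , cong (cell la v ∷_) eq
    scanA ((suc zero , v) ∷ r')             sf h = [] , v , r' , refl
    scanA ((suc (suc zero) , v) ∷ r')       sf h = ⊥-elim (h ((λ ()) , (λ ())))
    scanA ((suc (suc (suc i)) , v) ∷ r')    sf h = ⊥-elim (h ((λ ()) , (λ ())))

    scanB : ∀ r → Suffix r W → ¬ SatHead d₀ (A ∨ K) r →
            Σ (List Val) λ bs → Σ (List Cl) λ rest → (r ≡ run lb bs ++ rest) × BlockEnd rest
    scanB [] sf h = [] , [] , refl , inj₁ refl
    scanB ((zero , v) ∷ r')          sf h = ⊥-elim (h (∨-l {s = cell la v} {r = r'} {d = d₀} A K refl))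
    scanB ((suc zero , v) ∷ r')      sf h = ⊥-elim (h (∨-r {s = cell lk v} {r = r'} {d = d₀} A K refl))
    scanB ((suc (suc zero) , v) ∷ r') sf h with scanB r' (suffix-tail sf) (afterKB sf (∨-r {s = cell lb v} {r = r'} {d = d₀} K B refl))
    ... | bs , rest , eq , fin = v ∷ bs , rest , cong (cell lb v ∷_) eq , fin
    scanB ((suc (suc (suc i)) , v) ∷ r') sf h = [] , _ , refl , inj₂ (i , v , r' , refl)

    parse : ∀ i v r → Suffix (hcell i v ∷ r) W →
            Σ Block λ c → Σ (List Cl) λ rest → (hcell i v ∷ r ≡ c ▸ rest) × pc c ≡ i × BlockEnd rest
    parse i v r sf with scanA r (suffix-tail sf) (afterH sf)
    ... | as , kv , r' , refl with scanB r' (suffix-tail ksf) (afterKB ksf (∨-l {s = cell lk kv} {r = r'} {d = d₀} K B refl))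
      where ksf = suffix-++ (hcell i v ∷ run la as) {cell lk kv ∷ r'} sf
    ... | bs , rest , refl , fin = block i v as kv bs , rest , refl , refl , fin

    s₀ : Δ
    s₀ = proj₂ w₀ ax

    ρ₀ : PVal
    ρ₀ = restrictFull (proj₂ w₀) ax

    sep-hk : ∀ {t u} → Suffix (t ∷ u) W → Sat t u ρ₀ (isH ∨ K) → s₀ ≡ proj₂ t ax
    sep-hk {t} {u} sf h =
      ↑xx-e {s = t} {u} (proj₂ w₀)
            (⇒-e {s = t} {r = u} {d = ρ₀} (isH ∨ K) ux (always-e {d = ρ₀} {s = w₀} {r = W₀} ((isH ∨ K) ⇒ ux) (proj₁ (proj₂ model)) sf) h)

    sep-ab : ∀ {t u} → Suffix (t ∷ u) W → Sat t u ρ₀ (A ∨ B) → s₀ ≢ proj₂ t ax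
    sep-ab {t} {u} sf h eq =
      ⇒-e {s = t} {r = u} {d = ρ₀} (A ∨ B) (neg ux) (always-e {d = ρ₀} {s = w₀} {r = W₀} ((A ∨ B) ⇒ neg ux) (proj₁ (proj₂ (proj₂ model))) sf) h
          (↑xx-i {s = t} {u} (proj₂ w₀) eq)

    sep-start : ∀ k c rest → Suffix (c ▸ rest) W → s₀ ≡ proj₂ (startCell k c) ax
    sep-start c₁ c rest sf = sep-hk sf (∨-l {s = hcell (pc c) (hv c)} {r = body c rest} {d = ρ₀} isH K (isH-h {pc c} {hv c} {body c rest} {ρ₀}))
    sep-start c₂ c rest sf = sep-hk (suffix-trans (start-suffix c₂ c rest) sf) (∨-r {s = cell lk (kv c)} {r = run lb (bs c) ++ rest} {d = ρ₀} isH K refl)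

    isAB : ∀ k {v r d} → Sat (cell (ctr k) v) r d (A ∨ B)
    isAB c₁ {v} {r} {d} = ∨-l {s = cell la v} {r = r} {d = d} A B refl
    isAB c₂ {v} {r} {d} = ∨-r {s = cell lb v} {r = r} {d = d} A B refl

    link : ∀ {p t u} → Suffix (p ∷ t ∷ u) W → Sat t u (restrictFull (proj₂ p) ax) (A ∨ B) → proj₂ p ax ≡ proj₂ t ay
    link {p} {t} {u} sf ab =
      ↑xy-e {s = t} {u} (proj₂ p)
            (⇒-e {s = t} {r = u} {d = restrictFull (proj₂ p) ax} (A ∨ B) uy
                 (stable {s = t} {u} {restrictFull (proj₂ p) ax} ((A ∨ B) ⇒ uy) (proj₁ (proj₁ (proj₂ (inv sf))))) ab)

    chainRun : ∀ k p vs R → Suffix (p ∷ run (ctr k) vs ++ R) W → Chain (proj₂ p ax) vs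
    chainRun k p []       R sf = []
    chainRun k p (e ∷ vs) R sf =
      sym (link {p} {cell (ctr k) e} {run (ctr k) vs ++ R} sf (isAB k {e} {run (ctr k) vs ++ R} {restrictFull (proj₂ p) ax})) ∷
      chainRun k (cell (ctr k) e) vs R (suffix-tail sf)

    distinctAt : ∀ k e t → Suffix (cell (ctr k) e ∷ t) W → ¬ UntilRun (ctr k) (restrictFull e ax) ux t
    distinctAt c₁ e t sf = ⇒-e {s = cell la e} {r = t} {d = d₀} (Run c₁) (down ax (neg (next (until (Run c₁) (conj (Run c₁) ux))))) (proj₁ (proj₂ (proj₁ (proj₂ (inv sf))))) refl
    distinctAt c₂ e t sf = ⇒-e {s = cell lb e} {r = t} {d = d₀} (Run c₂) (down ax (neg (next (until (Run c₂) (conj (Run c₂) ux))))) (proj₂ (proj₂ (proj₁ (proj₂ (inv sf))))) refl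

    uniqueRun : ∀ k vs R → Suffix (run (ctr k) vs ++ R) W → All (s₀ ≢_) (xvals vs) × Unique (xvals vs)
    uniqueRun k []       R sf = [] , []
    uniqueRun k (e ∷ vs) R sf =
      (sep-ab sf (isAB k {e} {run (ctr k) vs ++ R} {ρ₀}) ∷ proj₁ rest) ,
      (AllP.map⁺ (run-distinct (ctr k) e vs R (distinctAt k e _ sf)) ∷ proj₂ rest)
      where rest = uniqueRun k vs R (suffix-tail sf)

    pathOf : ∀ k c rest → Suffix (c ▸ rest) W → Path s₀ (runOf k c)
    pathOf k c rest sf =
      subst (λ v → Chain v (runOf k c)) (sym (sep-start k c rest sf)) (chainRun k (startCell k c) (runOf k c) _ ssf) ,
      (proj₁ u ∷ proj₂ u)
      where
      ssf = suffix-trans (start-suffix k c rest) sf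
      u = uniqueRun k (runOf k c) _ (suffix-tail ssf)

    lastOf-x : ∀ k c rest → Suffix (c ▸ rest) W → proj₂ (lastOf k c) ax ≡ end s₀ (runOf k c)
    lastOf-x k c rest sf = trans (lastCell-x (ctr k) (startCell k c) (runOf k c)) (cong (λ v → end v (runOf k c)) (sym (sep-start k c rest sf)))

    module Transition (c c' : Block) (rest' : List Cl) (sf : Suffix (c ▸ (c' ▸ rest')) W) (fin' : BlockEnd rest') where
      hd : Cl
      hd = hcell (pc c) (hv c)

      T : List Cl
      T = body c (c' ▸ rest')

      sf' : Suffix (c' ▸ rest') W
      sf' = blockSuffix c (c' ▸ rest') sf

      fin : BlockEnd (c' ▸ rest')
      fin = inj₂ (pc c' , hv c' , body c' rest' , refl)

      toNextBlock : ∀ {ρ} k φ pre → All (¬_ ∘ IsH) pre → UntilH ρ φ (pre ++ (between k c ++ (c' ▸ rest'))) →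
                    Sat (hcell (pc c') (hv c')) (body c' rest') ρ φ
      toNextBlock k φ pre ¬h u = atH-e φ (skipToH φ (between k c) (¬IsH-between k c) (skipToH φ pre ¬h u))

      nextPc : ∀ j → Sat hd T d₀ (atNextH (letter (lh j))) → pc c' ≡ j
      nextPc j h = lh-injective (toNextBlock {d₀} c₁ (letter (lh j)) (run la (as c)) (¬IsH-run c₁ (as c)) h)

      found : ∀ k e → Sat (hcell (pc c') (hv c')) (body c' rest') (restrictFull e az) (seek k) → Any (SamePair e) (runOf k c')
      found k e h = mapAny (λ {e'} q → proj₂ (↑zz-e {s = cell la e'} {[]} e q)) (seek-e k c' rest' fin' h)

      covered : ∀ k → Sat hd T d₀ (allCopied k) → All (λ e → Any (SamePair e) (runOf k c')) (runOf k c)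
      covered k h = along-run (ctr k) (runOf k c) R copiedCell
                              (run-none {d₀} (ctr k) (neg (copied k)) (runOf k c) R (toStart-e {d₀} k _ c (c' ▸ rest') h))
        where
        R = between k c ++ (c' ▸ rest')
        copiedCell : ∀ e post → ¬ Sat (cell (ctr k) e) (run (ctr k) post ++ R) d₀ (neg (copied k)) → Any (SamePair e) (runOf k c')
        copiedCell e post ¬¬cp =
          found k e (toNextBlock k (seek k) (run (ctr k) (e ∷ post)) (¬IsH-run k (e ∷ post))
                                 (stable {s = cell (ctr k) e} {run (ctr k) post ++ R} {d₀} (copied k) ¬¬cp))

      coveredButLast : ∀ k as₀ el → runOf k c ≡ as₀ ++ [ el ] → Sat hd T d₀ (allButLastCopied k) →
                       All (λ e → Any (SamePair e) (runOf k c')) as₀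
      coveredButLast k as₀ el eq h = along-run (ctr k) as₀ (cell (ctr k) el ∷ R) copiedCell (run-none {d₀} (ctr k) χ as₀ _ h')
        where
        R = between k c ++ (c' ▸ rest')
        χ = conj (next (Run k)) (neg (copied k))
        split : fromStart k c (c' ▸ rest') ≡ run (ctr k) as₀ ++ (cell (ctr k) el ∷ R)
        split = trans (cong (λ L → run (ctr k) L ++ R) eq)
                      (trans (cong (_++ R) (LP.map-++ (cell (ctr k)) as₀ [ el ])) (LP.++-assoc (run (ctr k) as₀) [ cell (ctr k) el ] R))
        h' : ¬ UntilRun (ctr k) d₀ χ (run (ctr k) as₀ ++ (cell (ctr k) el ∷ R))
        h' = subst (λ L → ¬ UntilRun (ctr k) d₀ χ L) split (toStart-e {d₀} k _ c (c' ▸ rest') h)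
        runNext : ∀ post → SatHead d₀ (Run k) (run (ctr k) post ++ (cell (ctr k) el ∷ R))
        runNext []      = refl
        runNext (_ ∷ _) = refl
        copiedCell : ∀ e post → ¬ Sat (cell (ctr k) e) (run (ctr k) post ++ (cell (ctr k) el ∷ R)) d₀ χ → Any (SamePair e) (runOf k c')
        copiedCell e post ¬χ =
          found k e (toNextBlock k (seek k) [] []
                       (skipToH (seek k) [ cell (ctr k) el ] (¬IsH-ctr k {el} ∷ [])
                         (skipToH (seek k) (run (ctr k) (e ∷ post)) (¬IsH-run k (e ∷ post))
                           (stable {s = cell (ctr k) e} {run (ctr k) post ++ (cell (ctr k) el ∷ R)} {d₀} (copied k)
                                   (λ ¬cp → ¬χ (runNext post , ¬cp))))))

      compared : ∀ k att cond → Sat hd T d₀ (compareLast k att cond) →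
                 Sat (lastOf k c') (between k c' ++ rest') (restrictFull (proj₂ (lastOf k c)) att) cond
      compared k att cond h =
        atLast-e k cond c' rest' fin' (toNextBlock k (atLast k cond) [] [] (atLast-e k (down att (atNextH (atLast k cond))) c (c' ▸ rest') fin h))

      zero-run : ∀ k → Sat hd T d₀ (Zero k) → runOf k c ≡ []
      zero-run k h with runOf k c | toStart-e k (neg (next (Run k))) c (c' ▸ rest') h
      ... | []    | _  = refl
      ... | _ ∷ _ | ¬r = ⊥-elim (¬r refl)

      pos-run : ∀ k → Sat hd T d₀ (Pos k) → Σ (List Val) λ as₀ → Σ Val λ el → runOf k c ≡ as₀ ++ [ el ]
      pos-run k h with snocView (runOf k c)
      ... | inj₂ r  = r
      ... | inj₁ eq = ⊥-elim (noRun k (subst (λ L → SatHead d₀ (Run k) (run (ctr k) L ++ (between k c ++ (c' ▸ rest')))) eq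
                                             (toStart-e k (next (Run k)) c (c' ▸ rest') h)))
        where
        noRun : ∀ k → ¬ SatHead d₀ (Run k) (between k c ++ (c' ▸ rest'))
        noRun c₁ ()
        noRun c₂ ()

      path : ∀ k → Path s₀ (runOf k c) × Path s₀ (runOf k c')
      path k = pathOf k c (c' ▸ rest') sf , pathOf k c' rest' sf'

      keep : ∀ k → Sat hd T d₀ (Keep k) → counter k (config c') ≡ counter k (config c)
      keep k (cov , cmp) =
        trans (counter-config k c')
              (trans (keep-length s₀ (runOf k c) (runOf k c') (proj₁ (path k)) (proj₂ (path k)) (covered k cov) ends)
                     (sym (counter-config k c)))
        where
        ends : end s₀ (runOf k c') ≡ end s₀ (runOf k c)
        ends = trans (sym (lastOf-x k c' rest' sf'))
                     (trans (sym (↑xx-e {s = lastOf k c'} {between k c' ++ rest'} (proj₂ (lastOf k c)) (compared k ax ux cmp)))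
                            (lastOf-x k c (c' ▸ rest') sf))

      incr : ∀ k → Sat hd T d₀ (Incr k) → counter k (config c') ≡ suc (counter k (config c))
      incr k (cov , cmp) with snocView (runOf k c') | compared k ax (conj (Run k) uy) cmp
      ... | inj₁ eq | (isRun , _) = ⊥-elim (startNotRun k (subst (λ L → proj₁ (lastCell (ctr k) (startCell k c') L) ≡ ctr k) eq isRun))
        where
        startNotRun : ∀ k → proj₁ (startCell k c') ≢ ctr k
        startNotRun c₁ ()
        startNotRun c₂ ()
      ... | inj₂ (cs , e , eq) | (_ , q) =
        trans (counter-config k c')
              (trans (cong length eq)
                     (trans (inc-length s₀ (runOf k c) cs e (proj₁ (path k)) (subst (Path s₀) eq (proj₂ (path k)))
                                        (subst (λ L → All (λ e → Any (SamePair e) L) (runOf k c)) eq (covered k cov)) ye)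
                            (cong suc (sym (counter-config k c)))))
        where
        ye : e ay ≡ end s₀ (runOf k c)
        ye = trans (cong (λ s → proj₂ s ay) (sym (trans (cong (lastCell (ctr k) (startCell k c')) eq) (lastCell-snoc (ctr k) (startCell k c') cs e))))
                   (trans (sym (↑xy-e {s = lastOf k c'} {between k c' ++ rest'} (proj₂ (lastOf k c)) q)) (lastOf-x k c (c' ▸ rest') sf))

      decr : ∀ k → Sat hd T d₀ (Pos k) → Sat hd T d₀ (Decr k) → suc (counter k (config c')) ≡ counter k (config c)
      decr k pos (cov , cmp) with pos-run k pos
      ... | as₀ , el , eq =
        trans (cong suc (counter-config k c'))
              (trans (dec-length s₀ as₀ el (runOf k c') (subst (Path s₀) eq (proj₁ (path k))) (proj₂ (path k)) (coveredButLast k as₀ el eq cov) le)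
                     (trans (cong length (sym eq)) (sym (counter-config k c))))
        where
        le : end s₀ (runOf k c') ≡ el ay
        le = trans (sym (lastOf-x k c' rest' sf'))
                   (trans (sym (↑yx-e {s = lastOf k c'} {between k c' ++ rest'} (proj₂ (lastOf k c)) (compared k ay ux cmp)))
                          (cong (λ s → proj₂ s ay) (trans (cong (lastCell (ctr k) (startCell k c)) eq) (lastCell-snoc (ctr k) (startCell k c) as₀ el))))

    performs : ∀ c rest → Suffix (c ▸ rest) W →
               Sat (hcell (pc c) (hv c)) (body c rest) d₀ (transition (P (pc c)))
    performs c rest sf =
      ⇒-e {s = hcell (pc c) (hv c)} {r = body c rest} {d = d₀} (letter (lh (pc c))) (transition (P (pc c)))
          (⋀-e {s = hcell (pc c) (hv c)} {r = body c rest} {d = d₀} (suc n) (λ i → letter (lh i) ⇒ transition (P i))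
               (proj₂ (proj₂ (inv sf))) (pc c))
          refl

    following : ∀ c rest j → Suffix (c ▸ rest) W → BlockEnd rest →
                Sat (hcell (pc c) (hv c)) (body c rest) d₀ (atNextH (letter (lh j))) →
                Σ Block λ c' → Σ (List Cl) λ rest' → (rest ≡ c' ▸ rest') × BlockEnd rest'
    following c rest j sf fin h with fin | skipToH {d₀} (letter (lh j)) (between c₁ c) (¬IsH-between c₁ c)
                                          (skipToH {d₀} (letter (lh j)) (run la (as c)) (¬IsH-run c₁ (as c)) h)
    ... | inj₁ refl                 | ()
    ... | inj₂ (i , v , u , refl) | _ with parse i v u (blockSuffix c (hcell i v ∷ u) sf)
    ...   | c' , rest' , eq , _ , fin' = c' , rest' , eq , fin'

    Successor : Block → List Cl → Set
    Successor c rest = Σ Block λ c' → Σ (List Cl) λ rest' → (rest ≡ c' ▸ rest') × BlockEnd rest' × Step P (config c) (config c')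

    advance : ∀ c rest → Suffix (c ▸ rest) W → BlockEnd rest → P (pc c) ≡ HALT ⊎ Successor c rest
    advance c rest sf fin with P (pc c) in eq | performs c rest sf
    ... | HALT | _ = inj₁ refl
    ... | INC k j | (nh , inc , kp) with following c rest j sf fin nh
    ...   | c' , rest' , refl , fin' = inj₂ (c' , rest' , refl , fin' , inc-step k eq (nextPc j nh) (incr k inc) (keep (other k) kp))
      where open Transition c c' rest' sf fin'
    advance c rest sf fin | DEC k j l | tr with ∨-e {s = hcell (pc c) (hv c)} {r = body c rest} {d = d₀} (zeroBranch k l) (posBranch k j) tr
    ... | inj₁ (z , nh , kp , kpo) with following c rest l sf fin nh
    ...   | c' , rest' , refl , fin' =
      inj₂ (c' , rest' , refl , fin' , dec-zero-step k eq (nextPc l nh) zero₀ (trans (keep k kp) zero₀) (keep (other k) kpo))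
      where
      open Transition c c' rest' sf fin'
      zero₀ = trans (counter-config k c) (cong length (zero-run k z))
    advance c rest sf fin | DEC k j l | tr | inj₂ (pos , nh , dc , kpo) with following c rest j sf fin nh
    ...   | c' , rest' , refl , fin' = inj₂ (c' , rest' , refl , fin' , dec-suc-step k eq (nextPc j nh) (decr k pos dc) (keep (other k) kpo))
      where open Transition c c' rest' sf fin'

    -- Following the blocks from a reachable configuration eventually reaches
    -- HALT (the fuel bounds the number of remaining cells).
    follow : ∀ fuel c rest → length rest ℕ.< fuel → Suffix (c ▸ rest) W → BlockEnd rest →
             Star (Step P) (zero , 0 , 0) (config c) → Halts (n , P)
    follow (suc fuel) c rest lt sf fin reach with advance c rest sf fin
    ... | inj₁ halt = config c , reach , halt
    ... | inj₂ (c' , rest' , refl , fin' , s) =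
      follow fuel c' rest' (ℕP.<-≤-trans (shorter c' rest') (ℕP.≤-pred lt)) (blockSuffix c (c' ▸ rest') sf) fin' (reach ◅◅ (s ◅ ε))
      where
      shorter : ∀ c' rest' → length rest' ℕ.< length (c' ▸ rest')
      shorter c' rest' =
        s≤s (length-suffix (suffix-trans (suffix-trans (suffix-++ʳ (run lb (bs c'))) (suffix-step suffix-refl)) (suffix-++ʳ (run la (as c')))))

    initialRuns : ∀ as kv bs rest → SatHead d₀ (conj K (neg (next B))) (run la as ++ cell lk kv ∷ (run lb bs ++ rest)) →
                  as ≡ [] × bs ≡ []
    initialRuns []      kv []      rest _        = refl , refl
    initialRuns []      kv (_ ∷ _) rest (_ , ¬b) = ⊥-elim (¬b refl)
    initialRuns (_ ∷ _) kv bs      rest (() , _)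

    firstBlock : Suffix (hcell zero (proj₂ w₀) ∷ W₀) W
    firstBlock = subst (λ l → Suffix ((l , proj₂ w₀) ∷ W₀) W) (proj₁ (proj₁ model)) suffix-refl

    halts : Halts (n , P)
    halts with parse zero (proj₂ w₀) W₀ firstBlock
    ... | c , rest , eq , pc₀ , fin = follow (suc (length rest)) c rest (ℕP.n<1+n _) (subst (λ L → Suffix L W) eq firstBlock) fin reach₀
      where
      empty = initialRuns (as c) (kv c) (bs c) rest (subst (SatHead d₀ (conj K (neg (next B)))) (proj₂ (LP.∷-injective eq)) (proj₂ (proj₁ model)))
      reach₀ : Star (Step P) (zero , 0 , 0) (config c)
      reach₀ = subst (Star (Step P) (zero , 0 , 0)) (sym (cong₂ _,_ pc₀ (cong₂ _,_ (cong length (proj₁ empty)) (cong length (proj₂ empty))))) ε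

  -- (7) Completeness: the encoding of a halting run is a model of Φ.
  module Completeness where
    -- All h- and k-cells carry z̄; the j-th cell of a run carries unit j, so a
    -- counter value m is stored as the chain 0 → 1 → … → m.
    z̄ : Val
    z̄ _ = 0

    unit : ℕ → Val
    unit j ax = suc j
    unit j ay = j
    unit j az = suc j

    units : ℕ → ℕ → List Val
    units j zero    = []
    units j (suc m) = unit j ∷ units (suc j) m

    encode : Config (suc n) → Block
    encode x = block (proj₁ x) z̄ (units 0 (counter c₁ x)) z̄ (units 0 (counter c₂ x))

    runOf-encode : ∀ k x → runOf k (encode x) ≡ units 0 (counter k x)
    runOf-encode c₁ x = refl
    runOf-encode c₂ x = refl

    lastCell-units-x : ∀ ℓ s j m → proj₂ s ax ≡ j → proj₂ (lastCell ℓ s (units j m)) ax ≡ j + m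
    lastCell-units-x ℓ s j zero    e = trans e (sym (ℕP.+-identityʳ j))
    lastCell-units-x ℓ s j (suc m) e = trans (lastCell-units-x ℓ (cell ℓ (unit j)) (suc j) m refl) (sym (ℕP.+-suc j m))

    lastCell-units-y : ∀ ℓ s j m → proj₂ (lastCell ℓ s (units j (suc m))) ay ≡ j + m
    lastCell-units-y ℓ s j zero    = sym (ℕP.+-identityʳ j)
    lastCell-units-y ℓ s j (suc m) = trans (lastCell-units-y ℓ (cell ℓ (unit j)) (suc j) m) (sym (ℕP.+-suc j m))

    lastCell-units-letter : ∀ ℓ s j m → proj₁ (lastCell ℓ s (units j (suc m))) ≡ ℓ
    lastCell-units-letter ℓ s j zero    = refl
    lastCell-units-letter ℓ s j (suc m) = lastCell-units-letter ℓ (cell ℓ (unit j)) (suc j) m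

    lastOf-x : ∀ k x → proj₂ (lastOf k (encode x)) ax ≡ counter k x
    lastOf-x c₁ x = lastCell-units-x la (hcell (proj₁ x) z̄) 0 (counter c₁ x) refl
    lastOf-x c₂ x = lastCell-units-x lb (cell lk z̄) 0 (counter c₂ x) refl

    lastOf-y : ∀ k x {m} → counter k x ≡ suc m → proj₂ (lastOf k (encode x)) ay ≡ m
    lastOf-y k x {m} e = subst (λ vs → proj₂ (lastCell (ctr k) (startCell k (encode x)) vs) ay ≡ m)
                               (sym (trans (runOf-encode k x) (cong (units 0) e)))
                               (lastCell-units-y (ctr k) (startCell k (encode x)) 0 m)

    lastOf-letter : ∀ k x {m} → counter k x ≡ suc m → proj₁ (lastOf k (encode x)) ≡ ctr k
    lastOf-letter k x {m} e = subst (λ vs → proj₁ (lastCell (ctr k) (startCell k (encode x)) vs) ≡ ctr k)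
                                    (sym (trans (runOf-encode k x) (cong (units 0) e)))
                                    (lastCell-units-letter (ctr k) (startCell k (encode x)) 0 m)

    along-units : ∀ {Q : Cl → List Cl → Set} ℓ i m R →
                  (∀ j m' → j + suc m' ≡ i + m → Q (cell ℓ (unit j)) (run ℓ (units (suc j) m') ++ R)) →
                  Along Q (run ℓ (units i m)) R
    along-units ℓ i zero    R f = []
    along-units ℓ i (suc m) R f = f i m refl ∷ along-units ℓ (suc i) m R (λ j m' e → f j m' (trans e (sym (ℕP.+-suc i m))))

    before : ∀ {j m' a} → j + suc m' ≡ a → j ℕ.< a
    before {j} refl = ℕP.m<m+n j (s≤s z≤n)

    find-i : ∀ {P Q : Cl → List Cl → Set} ℓ s i m R j → (∀ {t} → P s t) → (∀ {v t} → P (cell ℓ v) t) →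
             i ℕ.≤ j → j ℕ.< i + m → (∀ {t} → Q (cell ℓ (unit j)) t) → Until P Q s (run ℓ (units i m) ++ R)
    find-i ℓ s i zero R j p ps i≤j j<i q = ⊥-elim (ℕP.<⇒≱ (subst (j ℕ.<_) (ℕP.+-identityʳ i) j<i) i≤j)
    find-i ℓ s i (suc m) R j p ps i≤j j<i q with i ℕ.≟ j
    ... | yes refl = step p (here q)
    ... | no i≢j   = step p (find-i ℓ (cell ℓ (unit i)) (suc i) m R j ps ps (ℕP.≤∧≢⇒< i≤j i≢j) (subst (j ℕ.<_) (ℕP.+-suc i m) j<i) q)

    uz-unit : ∀ ℓ j {t} → Sat (cell ℓ (unit j)) t (restrictFull (unit j) az) uz
    uz-unit ℓ j {t} = ↑zz-i {s = cell ℓ (unit j)} {t} (unit j) refl (inj₁ (refl , refl))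

    -- The x-values of a run of units increase, so an earlier one does not recur.
    units-distinct : ∀ ℓ i m R j → j ℕ.< i → Along (λ a t → ¬ Sat a t (restrictFull (unit j) ax) ux) (run ℓ (units i m)) R
    units-distinct ℓ i zero    R j j<i = []
    units-distinct ℓ i (suc m) R j j<i =
      (λ q → ℕP.<⇒≢ j<i (ℕP.suc-injective (↑xx-e {s = cell ℓ (unit i)} {run ℓ (units (suc i) m) ++ R} (unit j) q))) ∷
      units-distinct ℓ (suc i) m R j (ℕP.m≤n⇒m≤1+n j<i)

    seek-i : ∀ k y R' → BlockEnd R' → ∀ j → j ℕ.< counter k y →
             Sat (hcell (proj₁ y) z̄) (body (encode y) R') (restrictFull (unit j) az) (seek k)
    seek-i c₁ y R' fin j lt =
      find-i {P = λ s r → Sat s r (restrictFull (unit j) az) (neg K)} {Q = λ s r → Sat s r (restrictFull (unit j) az) (conj A uz)}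
             la (hcell (proj₁ y) z̄) 0 (counter c₁ y) (cell lk z̄ ∷ (run lb (units 0 (counter c₂ y)) ++ R')) j (λ ()) (λ ()) z≤n lt (λ {t} → refl , uz-unit la j {t})
    seek-i c₂ y R' fin j lt =
      atK-i (until (neg isH) (conj B uz)) (proj₁ y) z̄ (units 0 (counter c₁ y)) z̄ (run lb (units 0 (counter c₂ y)) ++ R')
            (find-i {P = λ s r → Sat s r (restrictFull (unit j) az) (neg isH)} {Q = λ s r → Sat s r (restrictFull (unit j) az) (conj B uz)}
                    lb (cell lk z̄) 0 (counter c₂ y) R' j (λ { (_ , ¬k , _) → ¬k refl }) (λ { (_ , _ , ¬b) → ¬b refl }) z≤n lt (λ {t} → refl , uz-unit lb j {t}))

    module StepFormulas (x y : Config (suc n)) (R' : List Cl) (fin' : BlockEnd R') (d : PVal) where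
      c c' : Block
      c  = encode x
      c' = encode y

      hd : Cl
      hd = hcell (proj₁ x) z̄

      T : List Cl
      T = body c (c' ▸ R')

      R : Ctr → List Cl
      R k = between k c ++ (c' ▸ R')

      fin : BlockEnd (c' ▸ R')
      fin = inj₂ (proj₁ y , z̄ , body c' R' , refl)

      nextH-i : Sat hd T d (atNextH (letter (lh (proj₁ y))))
      nextH-i = prefixToH {d} (letter (lh (proj₁ y))) (run la (as c)) (¬IsH-run c₁ (as c))
                  (prefixToH {d} (letter (lh (proj₁ y))) (between c₁ c) (¬IsH-between c₁ c) (atH-i {d} (letter (lh (proj₁ y))) refl))

      copied-i : ∀ k j post → j ℕ.< counter k y → Sat (cell (ctr k) (unit j)) (run (ctr k) post ++ R k) d (copied k)
      copied-i k j post lt =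
        prefixToH (seek k) (run (ctr k) (unit j ∷ post)) (¬IsH-run k (unit j ∷ post))
          (prefixToH (seek k) (between k c) (¬IsH-between k c) (atH-i (seek k) (seek-i k y R' fin' j lt)))

      inRun : ∀ k (P : List Val → Set) → P (units 0 (counter k x)) → P (runOf k c)
      inRun k P = subst P (sym (runOf-encode k x))

      copies-i : ∀ k → counter k x ℕ.≤ counter k y → Sat hd T d (allCopied k)
      copies-i k le =
        toStart-i k _ c (c' ▸ R')
          (inRun k (λ vs → ¬ UntilRun (ctr k) d (neg (copied k)) (run (ctr k) vs ++ R k))
            (run-none⁻ {d} (ctr k) (neg (copied k)) (units 0 (counter k x)) (R k) (run-ends k c c' R')
              (along-units (ctr k) 0 (counter k x) (R k) (λ j m' e ¬cp → ¬cp (copied-i k j (units (suc j) m') (ℕP.<-≤-trans (before e) le))))))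

      copiesButLast-i : ∀ k → counter k x ≡ suc (counter k y) → Sat hd T d (allButLastCopied k)
      copiesButLast-i k e =
        toStart-i k _ c (c' ▸ R')
          (inRun k (λ vs → ¬ UntilRun (ctr k) d χ (run (ctr k) vs ++ R k))
            (run-none⁻ {d} (ctr k) χ (units 0 (counter k x)) (R k) (run-ends k c c' R') (along-units (ctr k) 0 (counter k x) (R k) notLast)))
        where
        χ = conj (next (Run k)) (neg (copied k))
        notLast : ∀ j m' → j + suc m' ≡ 0 + counter k x → ¬ Sat (cell (ctr k) (unit j)) (run (ctr k) (units (suc j) m') ++ R k) d χ
        notLast j zero     _  (r , _)   = run-ends k c c' R' r
        notLast j (suc m') eq (_ , ¬cp) =
          ¬cp (copied-i k j (units (suc j) (suc m')) (before (ℕP.suc-injective (trans (sym (ℕP.+-suc j (suc m'))) (trans eq e)))))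

      compare-i : ∀ k att cond → Sat (lastOf k c') (between k c' ++ R') (restrictFull (proj₂ (lastOf k c)) att) cond →
                  Sat hd T d (compareLast k att cond)
      compare-i k att cond h =
        atLast-i k _ c (c' ▸ R') fin
          (prefixToH (atLast k cond) (between k c) (¬IsH-between k c) (atH-i (atLast k cond) (atLast-i k cond c' R' fin' h)))

      keep-i : ∀ k → counter k y ≡ counter k x → Sat hd T d (Keep k)
      keep-i k e = copies-i k (ℕP.≤-reflexive (sym e)) ,
                   compare-i k ax ux (↑xx-i {s = lastOf k c'} {between k c' ++ R'} _ (trans (lastOf-x k x) (trans (sym e) (sym (lastOf-x k y)))))

      incr-i : ∀ k → counter k y ≡ suc (counter k x) → Sat hd T d (Incr k)
      incr-i k e = copies-i k (subst (counter k x ℕ.≤_) (sym e) (ℕP.n≤1+n _)) ,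
                   compare-i k ax (conj (Run k) uy)
                     (lastOf-letter k y e , ↑xy-i {s = lastOf k c'} {between k c' ++ R'} _ (trans (lastOf-x k x) (sym (lastOf-y k y e))))

      decr-i : ∀ k → counter k x ≡ suc (counter k y) → Sat hd T d (Decr k)
      decr-i k e = copiesButLast-i k e ,
                   compare-i k ay ux (↑yx-i {s = lastOf k c'} {between k c' ++ R'} _ (trans (lastOf-y k x e) (sym (lastOf-x k y))))

      zero-i : ∀ k → counter k x ≡ 0 → Sat hd T d (Zero k)
      zero-i k e = toStart-i k _ c (c' ▸ R')
                     (subst (λ vs → ¬ SatHead d (Run k) (run (ctr k) vs ++ R k)) (sym (trans (runOf-encode k x) (cong (units 0) e)))
                            (run-ends k c c' R'))

      pos-i : ∀ k {m} → counter k x ≡ suc m → Sat hd T d (Pos k)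
      pos-i k e = toStart-i k _ c (c' ▸ R')
                    (subst (λ vs → SatHead d (Run k) (run (ctr k) vs ++ R k)) (sym (trans (runOf-encode k x) (cong (units 0) e))) refl)

    ρ₀ : PVal
    ρ₀ = restrictFull z̄ ax

    transition-i : ∀ {x y} → Step P x y → ∀ R' → BlockEnd R' →
                   Sat (hcell (proj₁ x) z̄) (body (encode x) (encode y ▸ R')) ρ₀ (transition (P (proj₁ x)))
    transition-i (inc₁ eq) R' fin' rewrite eq = nextH-i , incr-i c₁ refl , keep-i c₂ refl
      where open StepFormulas _ _ R' fin' ρ₀
    transition-i (inc₂ eq) R' fin' rewrite eq = nextH-i , incr-i c₂ refl , keep-i c₁ refl
      where open StepFormulas _ _ R' fin' ρ₀
    transition-i {x} {y} (dec₁z {j = j} {l} eq) R' fin' rewrite eq =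
      ∨-l {s = hd} {T} {ρ₀} (zeroBranch c₁ l) (posBranch c₁ j)
          (zero-i c₁ refl , nextH-i , keep-i c₁ refl , keep-i c₂ refl)
      where open StepFormulas x y R' fin' ρ₀
    transition-i {x} {y} (dec₁s {j = j} {l} eq) R' fin' rewrite eq =
      ∨-r {s = hd} {T} {ρ₀} (zeroBranch c₁ l) (posBranch c₁ j)
          (pos-i c₁ refl , nextH-i , decr-i c₁ refl , keep-i c₂ refl)
      where open StepFormulas x y R' fin' ρ₀
    transition-i {x} {y} (dec₂z {j = j} {l} eq) R' fin' rewrite eq =
      ∨-l {s = hd} {T} {ρ₀} (zeroBranch c₂ l) (posBranch c₂ j)
          (zero-i c₂ refl , nextH-i , keep-i c₂ refl , keep-i c₁ refl)
      where open StepFormulas x y R' fin' ρ₀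
    transition-i {x} {y} (dec₂s {j = j} {l} eq) R' fin' rewrite eq =
      ∨-r {s = hd} {T} {ρ₀} (zeroBranch c₂ l) (posBranch c₂ j)
          (pos-i c₂ refl , nextH-i , decr-i c₂ refl , keep-i c₁ refl)
      where open StepFormulas x y R' fin' ρ₀

    Good : Cl → List Cl → Set
    Good t u = Sat t u ρ₀ Invariant × Sat t u ρ₀ ((isH ∨ K) ⇒ ux) × Sat t u ρ₀ ((A ∨ B) ⇒ neg ux)

    nextAK : ∀ {d} vs v L → SatHead d (A ∨ K) (run la vs ++ cell lk v ∷ L)
    nextAK []      v L (_ , ¬k) = ¬k refl
    nextAK (_ ∷ _) v L (¬a , _) = ¬a refl

    nextNotAK : ∀ {d} vs L → BlockEnd L → ¬ SatHead d (A ∨ K) (run lb vs ++ L)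
    nextNotAK (_ ∷ _) L                 _                          h = h ((λ ()) , (λ ()))
    nextNotAK []      []                (inj₁ refl)                ()
    nextNotAK []      (_ ∷ _)           (inj₂ (_ , _ , _ , refl)) h = h ((λ ()) , (λ ()))

    noAB-end : ∀ {d L} → BlockEnd L → ¬ SatHead d (A ∨ B) L
    noAB-end (inj₁ refl)                ()
    noAB-end (inj₂ (_ , _ , _ , refl)) h = h ((λ ()) , (λ ()))

    noB-end : ∀ {L} → BlockEnd L → ¬ AtHead (λ s _ → proj₁ s ≡ lb) L
    noB-end (inj₁ refl)                ()
    noB-end (inj₂ (_ , _ , _ , refl)) ()

    linked-i : ∀ ℓ (s : Cl) j m L → proj₂ s ax ≡ j → (∀ {d} → ¬ SatHead d (A ∨ B) L) → Sat s (run ℓ (units j m) ++ L) ρ₀ linked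
    linked-i ℓ s j zero    []      e ¬ab ()
    linked-i ℓ s j zero    (t ∷ u) e ¬ab nn = nn (λ (ab , _) → ¬ab {restrictFull (proj₂ s) ax} ab)
    linked-i ℓ s j (suc m) L       e ¬ab nn = nn (λ (_ , ¬y) → ¬y (↑xy-i {s = cell ℓ (unit j)} {run ℓ (units (suc j) m) ++ L} (proj₂ s) e))

    good-h : ∀ x R → BlockEnd R → Sat (hcell (proj₁ x) z̄) (body (encode x) R) ρ₀ (transition (P (proj₁ x))) →
             Good (hcell (proj₁ x) z̄) (body (encode x) R)
    good-h x R fin tr =
      ( ( (λ (_ , ¬q) → ¬q (nextAK {ρ₀} (units 0 (counter c₁ x)) z̄ (run lb (units 0 (counter c₂ x)) ++ R)))
        , (λ { (() , _) })
        , (λ (kb , _) → kb ((λ ()) , (λ ()))) )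
      , ( linked-i la (hcell (proj₁ x) z̄) 0 (counter c₁ x) _ refl (λ h → h ((λ ()) , (λ ())))
        , (λ { (() , _) })
        , (λ { (() , _) }) )
      , ⋀-i {s = hd} {T} {ρ₀} (suc n) (λ i → letter (lh i) ⇒ transition (P i)) (λ i (lab , ¬tr) → ¬tr (subst (λ j → Sat hd T ρ₀ (transition (P j))) (lh-injective lab) tr)) )
      , (λ (_ , ¬u) → ¬u (↑xx-i {s = hd} {T} z̄ refl))
      , (λ (ab , _) → ab ((λ ()) , (λ ())))
      where
      hd = hcell (proj₁ x) z̄
      T = body (encode x) R

    good-a : ∀ j m b R → BlockEnd R → Good (cell la (unit j)) (run la (units (suc j) m) ++ cell lk z̄ ∷ (run lb (units 0 b) ++ R))
    good-a j m b R fin =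
      ( ( (λ (h , _) → proj₁ h refl)
        , (λ (_ , ¬q) → ¬q (nextAK {ρ₀} (units (suc j) m) z̄ (run lb (units 0 b) ++ R)))
        , (λ (kb , _) → kb ((λ ()) , (λ ()))) )
      , ( linked-i la (cell la (unit j)) (suc j) m _ refl (λ h → h ((λ ()) , (λ ())))
        , (λ (_ , ¬q) → ¬q (run-none⁻ {restrictFull (unit j) ax} la ux (units (suc j) m) L (λ ()) (units-distinct la (suc j) m L j (ℕP.n<1+n j))))
        , (λ { (() , _) }) )
      , ⋀-i {s = cell la (unit j)} {T} {ρ₀} (suc n) (λ i → letter (lh i) ⇒ transition (P i)) (λ i → λ { (() , _) }) )
      , (λ (hk , _) → hk ((λ h → proj₁ h refl) , (λ ())))
      , (λ (_ , ¬¬u) → ¬¬u (λ u → case ↑xx-e {s = cell la (unit j)} {T} z̄ u of λ ()))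
      where
      L = cell lk z̄ ∷ (run lb (units 0 b) ++ R)
      T = run la (units (suc j) m) ++ L

    good-k : ∀ b R → BlockEnd R → Good (cell lk z̄) (run lb (units 0 b) ++ R)
    good-k b R fin =
      ( ( (λ (h , _) → proj₁ (proj₂ h) refl)
        , (λ { (() , _) })
        , (λ (_ , ¬q) → ¬q (nextNotAK {ρ₀} (units 0 b) R fin)) )
      , ( linked-i lb (cell lk z̄) 0 b R refl (λ {d} → noAB-end {d} fin)
        , (λ { (() , _) })
        , (λ { (() , _) }) )
      , ⋀-i {s = cell lk z̄} {run lb (units 0 b) ++ R} {ρ₀} (suc n) (λ i → letter (lh i) ⇒ transition (P i)) (λ i → λ { (() , _) }) )
      , (λ (_ , ¬u) → ¬u (↑xx-i {s = cell lk z̄} {run lb (units 0 b) ++ R} z̄ refl))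
      , (λ (ab , _) → ab ((λ ()) , (λ ())))

    good-b : ∀ j m R → BlockEnd R → Good (cell lb (unit j)) (run lb (units (suc j) m) ++ R)
    good-b j m R fin =
      ( ( (λ (h , _) → proj₂ (proj₂ h) refl)
        , (λ { (() , _) })
        , (λ (_ , ¬q) → ¬q (nextNotAK {ρ₀} (units (suc j) m) R fin)) )
      , ( linked-i lb (cell lb (unit j)) (suc j) m R refl (λ {d} → noAB-end {d} fin)
        , (λ { (() , _) })
        , (λ (_ , ¬q) → ¬q (run-none⁻ {restrictFull (unit j) ax} lb ux (units (suc j) m) R (noB-end fin) (units-distinct lb (suc j) m R j (ℕP.n<1+n j)))) )
      , ⋀-i {s = cell lb (unit j)} {T} {ρ₀} (suc n) (λ i → letter (lh i) ⇒ transition (P i)) (λ i → λ { (() , _) }) )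
      , (λ (hk , _) → hk ((λ h → proj₂ (proj₂ h) refl) , (λ ())))
      , (λ (_ , ¬¬u) → ¬¬u (λ u → case ↑xx-e {s = cell lb (unit j)} {T} z̄ u of λ ()))
      where
      T = run lb (units (suc j) m) ++ R

    GoodAll : List Cl → Set
    GoodAll W = ∀ t u → Suffix (t ∷ u) W → Good t u

    goodAll-run : ∀ ℓ i m X → (∀ j m' → j + suc m' ≡ i + m → Good (cell ℓ (unit j)) (run ℓ (units (suc j) m') ++ X)) →
                  GoodAll X → GoodAll (run ℓ (units i m) ++ X)
    goodAll-run ℓ i zero    X f g = g
    goodAll-run ℓ i (suc m) X f g t u s with suffix-∷ s
    ... | inj₁ refl = f i m refl
    ... | inj₂ s'   = goodAll-run ℓ (suc i) m X (λ j m' e → f j m' (trans e (sym (ℕP.+-suc i m)))) g t u s'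

    goodAll-block : ∀ x X → BlockEnd X → Sat (hcell (proj₁ x) z̄) (body (encode x) X) ρ₀ (transition (P (proj₁ x))) →
                    GoodAll X → GoodAll (encode x ▸ X)
    goodAll-block x X fin tr g t u s with suffix-∷ s
    ... | inj₁ refl = good-h x X fin tr
    ... | inj₂ s₁   = goodAll-run la 0 (counter c₁ x) _ (λ j m' _ → good-a j m' (counter c₂ x) X fin) fromK t u s₁
      where
      fromK : GoodAll (cell lk z̄ ∷ (run lb (units 0 (counter c₂ x)) ++ X))
      fromK t u s₂ with suffix-∷ s₂
      ... | inj₁ refl = good-k (counter c₂ x) X fin
      ... | inj₂ s₃   = goodAll-run lb 0 (counter c₂ x) X (λ j m' _ → good-b j m' X fin) g t u s₃

    cellsOf restOf : ∀ {x y} → Star (Step P) x y → List Cl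
    cellsOf {x} r = encode x ▸ restOf r
    restOf ε       = []
    restOf (_ ◅ r) = cellsOf r

    restOf-end : ∀ {x y} (r : Star (Step P) x y) → BlockEnd (restOf r)
    restOf-end ε       = inj₁ refl
    restOf-end (_ ◅ _) = inj₂ (_ , z̄ , _ , refl)

    goodAll : ∀ {x y} (r : Star (Step P) x y) → P (proj₁ y) ≡ HALT → GoodAll (cellsOf r)
    goodAll {x} ε halt = goodAll-block x [] (inj₁ refl) halting (λ t u ())
      where
      halting : Sat (hcell (proj₁ x) z̄) (body (encode x) []) ρ₀ (transition (P (proj₁ x)))
      halting rewrite halt = true-i {s = hcell (proj₁ x) z̄} {body (encode x) []} {ρ₀}
    goodAll {x} (s ◅ r) halt = goodAll-block x (cellsOf r) (inj₂ (_ , z̄ , _ , refl)) (transition-i s (restOf r) (restOf-end r)) (goodAll r halt)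

    model : ∀ {y} (r : Star (Step P) (zero , 0 , 0) y) → P (proj₁ y) ≡ HALT →
            Sat (hcell zero z̄) (cell lk z̄ ∷ restOf r) ρ₀ Φ
    model r halt =
      (refl , refl , noB-end (restOf-end r)) ,
      always-i {d = ρ₀} {s = hcell zero z̄} {cell lk z̄ ∷ restOf r} ((isH ∨ K) ⇒ ux) (λ t u s → proj₁ (proj₂ (goodAll r halt t u s))) ,
      always-i {d = ρ₀} {s = hcell zero z̄} {cell lk z̄ ∷ restOf r} ((A ∨ B) ⇒ neg ux) (λ t u s → proj₂ (proj₂ (goodAll r halt t u s))) ,
      always-i {d = ρ₀} {s = hcell zero z̄} {cell lk z̄ ∷ restOf r} Invariant (λ t u s → proj₁ (goodAll r halt t u s))

cellAtList : ∀ {k} → Cell k → (r : List (Cell k)) → Fin (suc (length r)) → Cell k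
cellAtList s r       zero    = s
cellAtList s (t ∷ r) (suc i) = cellAtList t r i

toWord : ∀ {k} → Cell k → List (Cell k) → Word k
toWord s r = record { len = length r ; lab = proj₁ ∘ cellAtList s r ; dat = proj₂ ∘ cellAtList s r }

after-toWord : ∀ {k} (s : Cell k) r → after (cellAt (toWord s r)) zero ≡ r
after-toWord s []      = refl
after-toWord s (t ∷ r) = cong (t ∷_) (after-toWord t r)

reduction : Machine → SatInstance
reduction (n , P) = Encoding.Letters n P , Encoding.Φ n P

halting⇒satisfiable : ∀ M → Halts M → Satisfiable (reduction M)
halting⇒satisfiable (n , P) (_ , r , halt) =
  toWord (hcell zero z̄) W , ρ₀ ,
  Equivalence.from (models⇔sat (toWord (hcell zero z̄) W) Φ zero ρ₀)
                   (subst (λ L → Sat (hcell zero z̄) L ρ₀ Φ) (sym (after-toWord (hcell zero z̄) W)) (model r halt))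
  where
  open Encoding n P
  open Completeness
  W = cell lk z̄ ∷ restOf r

satisfiable⇒halting : ∀ M → Satisfiable (reduction M) → Halts M
satisfiable⇒halting (n , P) (w , d , sat) =
  Soundness.halts (cellAt w zero) (after (cellAt w) zero) d (Equivalence.to (models⇔sat w Φ zero d) sat)
  where open Encoding n P

lemma3 : Halts ⪯ Satisfiable
lemma3 = reduction , λ M → mk⇔ (halting⇒satisfiable M) (satisfiable⇒halting M)
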